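{- (1) Let $n\in\omega$, let $s\in\mathcal S(n+1)$, let $W(s)=\mathrm{ran}(\mathrm{wt}^s)$, and for each $k\in W(s)$ let $U_k$ be a uniform chain of rank $\omega$ such that $\mathrm f U_k\cong\mathrm f U_l$ for all $k,l\in W(s)$. Then the chain $\mathcal A(s)\{\langle U_k,k\rangle : k\in W(s)\}$ is a uniform chain of rank $\omega+n$. (2) Every uniform decomposable chain $A$ with $\omega<\mathrm{rk}(A)<\omega+\omega$ is isomorphic to a chain $\mathcal A(s)\{\langle U_k,k\rangle : k\in W(s)\}$ of this form.
   Context: A chain is a linearly ordered set; $\cong$ is order isomorphism. $A+B$ and $\sum_{i\in I}A_i$ are ordered sums, $AB=\sum_{b\in B}A$ is the anti-lexicographically ordered product; $\mathbb N,\mathbb Z$ have their usual orders and $1$ is the one-element chain. For a chain $A$ define convex equivalence relations $\rho_\alpha$ ($\alpha$ an ordinal): $\rho_0$ is equality; $A/\alpha$ is the quotient chain of $\rho_\alpha$-classes and $[x]_\alpha$ (the $\alpha$-component of $x$) is the class of $x$; $x\rho_{\alpha+1}y$ iff the interval between $[x]_\alpha$ and $[y]_\alpha$ in $A/\alpha$ is finite; for limit $\alpha$, $x\rho_\alpha y$ iff $x\rho_\beta y$ for some $\beta<\alpha$. The rank $\mathrm{rk}(A)$ is the least $\alpha$ with $A/\alpha\cong 1$; $A$ is decomposable if its rank is defined. All chains are assumed decomposable. $A$ is uniform if $A^{\ge x}=\{y\in A:x\le y\}$ has the same order type for all $x\in A$; then $\mathrm f A$ denotes this common tail. $\mathcal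 S(m)$ is the set of sequences $s=(s(0),\dots,s(m-1))$ of natural numbers with $s(i)\le i$ for all $i<m$; $|s|=m$ is the length. For $s$ of length $n+1\ge2$: $s^-$ is $s$ with its last entry deleted, and $s^+$ is $s$ with its next-to-last entry $s(n-1)$ deleted; $s^+\in\mathcal S(n)$ iff $s(n)<n$. The tree of $s$ (nonempty) has root $(s;0)$; a node $(t;k)$ with $|t|=m+1\ge 2$ has the single child $(t^-;0)$ if $t(m)=m$, and a left child $(t^+;k+1)$ and a right child $(t^-;0)$ if $t(m)<m$. The leaves are the nodes $(\langle 0\rangle;k)$ on level $|s|-1$, ordered from left to right; $\ell(s)$ is their number and $\mathrm{wt}^s(i)=k$ if the $i$th leaf ($0\le i<\ell(s)$) is $(\langle0\rangle;k)$. For uniform chains $M_i$ of rank $\omega$: $\mathcal A(\langle0\rangle)[M_0]=M_0$, and for $s$ of length $n+1\ge 2$, $\mathcal A(s)[M_0,\dots,M_{\ell(s)-1}]=\mathcal A(s^-)[M_0,\dots,M_{\ell(s^-)-1}]\,\mathbb Z$ if $s(n)=n$ (then $\ell(s)=\ell(s^-)$), and $=\mathcal A(s^+)[M_0,\dots,M_{\ell(s^+)-1}]+\mathcal A(s^-)[M_{\ell(s^+)},\dots,M_{\ell(s)-1}]\,\mathbb N$ if $s(n)<n$ (then $\ell(s)=\ell(s^+)+\ell(s^-)$). Finally $\mathcal A(s)\{\langle U_k,k\rangle:k\in W(s)\}:=\mathcal A(s)[M_0,\dots,M_{\ell(s)-1}]$ with $M_i=U_{\mathrm{wt}^s(i)}$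 for $i<\ell(s)$. -}

module Defs where

open import Level using (Level; _⊔_; Lift; lift; lower; 0ℓ) renaming (suc to lsuc)
open import Data.Nat.Base using (ℕ; zero; suc; _+_)
import Data.Nat.Properties as ℕ
import Data.Integer.Properties as ℤ
open import Data.Fin.Base using (Fin; _↑ˡ_; _↑ʳ_)
open import Data.Fin.Relation.Unary.Top using (view; ‵fromℕ; ‵inject₁)
open import Data.List.Base using (List)
open import Data.List.Relation.Unary.Any using (Any)
open import Data.Product.Base using (Σ-syntax; ∃-syntax; _×_; _,_; proj₁)
open import Data.Product.Relation.Binary.Lex.NonStrict using (×-totalOrder)
open import Data.Sum.Base using (_⊎_)
open import Data.Sum.Relation.Binary.LeftOrder using (⊎-<-totalOrder)
import Data.Unit.Properties as ⊤
open import Data.Vec.Functional using (_++_)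
open import Relation.Binary.Bundles using (TotalOrder; DecTotalOrder)
open import Relation.Binary.Bundles.Raw using (RawRelation)
import Relation.Binary.Construct.On as On
open import Relation.Binary.Core using (Rel)
open import Relation.Binary.Morphism.Structures using (IsOrderIsomorphism)
open import Relation.Binary.PropositionalEquality.Core using (_≡_)
open import Relation.Nullary.Negation.Core using (¬_)

------------------------------------------------------------------------
-- Chains

-- Equality on a chain is the setoid equality of the bundle, so a quotient of
-- a chain keeps the carrier and only changes the two relations.

Chain : (ℓ : Level) → Set (lsuc ℓ)
Chain ℓ = TotalOrder ℓ ℓ ℓ

∣_∣ : ∀ {ℓ} → Chain ℓ → Set ℓ
∣ A ∣ = TotalOrder.Carrier A

raw : ∀ {ℓ} → Chain ℓ → RawRelation ℓ ℓ ℓ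
raw A = record { _≈_ = TotalOrder._≈_ A ; _∼_ = TotalOrder._≤_ A }

infix 4 _≅ʳ_ _≅_

_≅ʳ_ : ∀ {c₁ c₂ e₁ e₂ r₁ r₂} → RawRelation c₁ e₁ r₁ → RawRelation c₂ e₂ r₂ →
       Set (c₁ ⊔ c₂ ⊔ e₁ ⊔ e₂ ⊔ r₁ ⊔ r₂)
R ≅ʳ S = ∃[ f ] IsOrderIsomorphism R._≈_ S._≈_ R._∼_ S._∼_ f
  where
  module R = RawRelation R
  module S = RawRelation S

_≅_ : ∀ {ℓ₁ ℓ₂} → Chain ℓ₁ → Chain ℓ₂ → Set (ℓ₁ ⊔ ℓ₂)
A ≅ B = raw A ≅ʳ raw B

infixl 6 _⊕_
infixl 7 _⊗_

_⊕_ : ∀ {ℓ} → Chain ℓ → Chain ℓ → Chain ℓ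
_⊕_ = ⊎-<-totalOrder

-- The library product is lexicographic; the anti-lexicographic A B is
-- obtained by listing the coordinate in B first.

_⊗_ : ∀ {ℓ ℓ′} → Chain ℓ → DecTotalOrder ℓ′ ℓ′ ℓ′ → Chain (ℓ ⊔ ℓ′)
A ⊗ B = ×-totalOrder B A

ℕᶜ : DecTotalOrder 0ℓ 0ℓ 0ℓ
ℕᶜ = ℕ.≤-decTotalOrder

ℤᶜ : DecTotalOrder 0ℓ 0ℓ 0ℓ
ℤᶜ = ℤ.≤-decTotalOrder

_^≥_ : ∀ {ℓ} (A : Chain ℓ) → ∣ A ∣ → Chain ℓ
A ^≥ x = On.totalOrder A (proj₁ {B = TotalOrder._≤_ A x})

Uniform : ∀ {ℓ} → Chain ℓ → Set ℓ
Uniform A = ∀ (x y : ∣ A ∣) → A ^≥ x ≅ A ^≥ y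

-- f A ≅ f B, for nonempty uniform A and B: there f A is the order type of
-- A ^≥ x for an arbitrary x.

SameTail : ∀ {ℓ} → Chain ℓ → Chain ℓ → Set ℓ
SameTail A B = ∀ (x : ∣ A ∣) (y : ∣ B ∣) → A ^≥ x ≅ B ^≥ y

------------------------------------------------------------------------
-- Ordinals

-- Tree presentations of ordinals: lim i₀ f is the supremum of the family f,
-- which is nonempty by i₀ but need not be increasing.  Distinct trees may
-- present the same ordinal; ≤ₒ compares the ordinals presented.

data Ord (ℓ : Level) : Set (lsuc ℓ) where
  zero : Ord ℓ
  suc  : Ord ℓ → Ord ℓ
  lim  : {I : Set ℓ} (i₀ : I) (f : I → Ord ℓ) → Ord ℓ

infix 4 _≤ₒ_ _<ₒ_

data _≤ₒ_ {ℓ} : Ord ℓ → Ord ℓ → Set (lsuc ℓ) where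
  zero≤   : ∀ {α} → zero ≤ₒ α
  suc≤suc : ∀ {α β} → α ≤ₒ β → suc α ≤ₒ suc β
  ≤lim    : ∀ {α} {I : Set ℓ} {i₀ : I} {f} i → α ≤ₒ f i → α ≤ₒ lim i₀ f
  lim≤    : ∀ {α} {I : Set ℓ} {i₀ : I} {f} → (∀ i → f i ≤ₒ α) → lim i₀ f ≤ₒ α

_<ₒ_ : ∀ {ℓ} → Ord ℓ → Ord ℓ → Set (lsuc ℓ)
α <ₒ β = suc α ≤ₒ β

infixl 6 _+ₒ_

_+ₒ_ : ∀ {ℓ} → Ord ℓ → Ord ℓ → Ord ℓ
α +ₒ zero     = α
α +ₒ suc β    = suc (α +ₒ β)
α +ₒ lim i₀ f = lim i₀ (λ i → α +ₒ f i)

finₒ : ∀ {ℓ} → ℕ → Ord ℓ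
finₒ zero    = zero
finₒ (suc n) = suc (finₒ n)

ω : ∀ {ℓ} → Ord ℓ
ω {ℓ} = lim {I = Lift ℓ ℕ} (lift 0) (λ n → finₒ (lower n))

------------------------------------------------------------------------
-- Condensations and rank

Interval : ∀ {c e r} (R : RawRelation c e r) → let open RawRelation R in
           Carrier → Carrier → Carrier → Set r
Interval R x y z = (x ∼ z × z ∼ y) ⊎ (y ∼ z × z ∼ x)
  where open RawRelation R

FiniteInterval : ∀ {c e r} (R : RawRelation c e r) → let open RawRelation R in
                 Carrier → Carrier → Set (c ⊔ e ⊔ r)
FiniteInterval R x y = Σ[ zs ∈ List Carrier ] (∀ z → Interval R x y z → Any (z ≈_) zs)
  where open RawRelation R

-- [x] ≤ [y] in the quotient of A by a convex equivalence ρ.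

quotient : ∀ {ℓ} (A : Chain ℓ) → Rel ∣ A ∣ ℓ → RawRelation ℓ ℓ ℓ
quotient A ρ = record { _≈_ = ρ ; _∼_ = λ x y → TotalOrder._≤_ A x y ⊎ ρ x y }

-- The lim clause is the union over an arbitrary family with supremum lim i₀ f.
-- As ρ is increasing in the ordinal, this is the union over all β < lim i₀ f
-- if the supremum is a limit not attained by f, and the ρ of the largest
-- member if it is attained.

ρ : ∀ {ℓ} (A : Chain ℓ) → Ord ℓ → Rel ∣ A ∣ ℓ
ρ A zero       x y = TotalOrder._≈_ A x y
ρ A (suc α)    x y = FiniteInterval (quotient A (ρ A α)) x y
ρ A (lim i₀ f) x y = ∃[ i ] ρ A (f i) x y

infix 7 _/_

_/_ : ∀ {ℓ} → Chain ℓ → Ord ℓ → RawRelation ℓ ℓ ℓ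
A / α = quotient A (ρ A α)

𝟙 : RawRelation 0ℓ 0ℓ 0ℓ
𝟙 = raw (DecTotalOrder.totalOrder ⊤.≡-decTotalOrder)

HasRank : ∀ {ℓ} → Chain ℓ → Ord ℓ → Set (lsuc ℓ)
HasRank A α = (A / α ≅ʳ 𝟙) × (∀ β → β <ₒ α → ¬ (A / β ≅ʳ 𝟙))

------------------------------------------------------------------------
-- Sequences and their trees

-- The entry at position m is an element of Fin (suc m), i.e. at most m.

infixl 5 _▷_

data 𝒮 : ℕ → Set where
  ⟨⟩  : 𝒮 0
  _▷_ : ∀ {m} → 𝒮 m → Fin (suc m) → 𝒮 (suc m)

-- In the recursions below s = t ▷ b ▷ a has length at least 2 and
-- s⁻ = t ▷ b.  The view of a separates s(n) = n (‵fromℕ) from s(n) < n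
-- (‵inject₁ a′, where a′ has the value of a); in the latter case s⁺ = t ▷ a′.

#leaves : ∀ {n} → 𝒮 (suc n) → ℕ
#leaves {zero}  s = 1
#leaves {suc n} (t ▷ b ▷ a) with view a
... | ‵fromℕ      = #leaves (t ▷ b)
... | ‵inject₁ a′ = #leaves (t ▷ a′) + #leaves (t ▷ b)

Node : Set
Node = (∃[ m ] 𝒮 (suc m)) × ℕ

-- Tree p: trees labelled by nodes, with p leaves.  Every leaf is (⟨0⟩;k) for
-- some k, as ⟨0⟩ is the only sequence of length 1, so only k is stored.

data Tree : ℕ → Set where
  leaf : (k : ℕ) → Tree 1
  one  : ∀ {p} → Node → Tree p → Tree p
  two  : ∀ {p q} → Node → Tree p → Tree q → Tree (p + q)

-- The subtree hanging from a node (s;k).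

tree : ∀ {n} (s : 𝒮 (suc n)) → ℕ → Tree (#leaves s)
tree {zero}  s k = leaf k
tree {suc n} s@(t ▷ b ▷ a) k with view a
... | ‵fromℕ      = one ((_ , s) , k) (tree (t ▷ b) 0)
... | ‵inject₁ a′ = two ((_ , s) , k) (tree (t ▷ a′) (suc k)) (tree (t ▷ b) 0)

leafLabel : ∀ {p} → Tree p → Fin p → ℕ
leafLabel (leaf k)    = λ _ → k
leafLabel (one _ u)   = leafLabel u
leafLabel (two _ u v) = leafLabel u ++ leafLabel v

wt : ∀ {n} (s : 𝒮 (suc n)) → Fin (#leaves s) → ℕ
wt s = leafLabel (tree s 0)

W : ∀ {n} → 𝒮 (suc n) → ℕ → Set
W s k = ∃[ i ] wt s i ≡ k

------------------------------------------------------------------------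
-- The chains 𝒜(s)

𝒜 : ∀ {ℓ n} (s : 𝒮 (suc n)) → (Fin (#leaves s) → Chain ℓ) → Chain ℓ
𝒜 {n = zero}  s M = M Fin.zero
𝒜 {n = suc n} (t ▷ b ▷ a) M with view a
... | ‵fromℕ      = 𝒜 (t ▷ b) M ⊗ ℤᶜ
... | ‵inject₁ a′ = 𝒜 (t ▷ a′) (λ i → M (i ↑ˡ #leaves (t ▷ b)))
                  ⊕ 𝒜 (t ▷ b) (λ i → M (#leaves (t ▷ a′) ↑ʳ i)) ⊗ ℕᶜ

-- U is given on all of ℕ so that U k depends on k alone, and not on the leaf
-- witnessing k ∈ W(s); its values off W(s) are irrelevant.

𝒜⟨_⟩ : ∀ {ℓ n} → 𝒮 (suc n) → (ℕ → Chain ℓ) → Chain ℓ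
𝒜⟨ s ⟩ U = 𝒜 s (λ i → U (wt s i))

record Admissible {ℓ n} (s : 𝒮 (suc n)) (U : ℕ → Chain ℓ) : Set (lsuc ℓ) where
  field
    uniform  : ∀ k → W s k → Uniform (U k)
    rank-ω   : ∀ k → W s k → HasRank (U k) ω
    sameTail : ∀ k l → W s k → W s l → SameTail (U k) (U l)

{-# OPTIONS --safe #-}
module Submission where

-- A grading of a chain A is a monotone map π from A to ℤ.  It exhibits A as the
-- ordered sum of its fibres, and isomorphisms of fibres glue to isomorphisms of
-- chains (Glue).  Since equality in ℤ is propositional, glueing needs no choice
-- of representatives that respects the equality of A.  Say that A is layered
-- over D if every fibre has the tails of D and every fibre above a nonempty one
-- is a copy of D.  For uniform D, the chains D ℤ and D₀ + D ℕ, where D₀ has the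
-- tails of D, are layered over D.  Two facts about layered chains give part (1).
--
-- * A tail of a chain layered over D is a tail of D followed by D ℕ.  So any two
--   chains layered over D have the same tails (Layered-Tails); in particular
--   each of them is uniform.
-- * If D has rank α then the nonempty fibres are the classes of ρ_α, and A has
--   rank α + 1 (layered-classes, Classes-Rank).  If two fibres were merged at a
--   stage γ + 1 ≤ α then the lower one would have a last class of ρ_γ, so some
--   tail of it, and by uniformity all of D, would lie in one class of ρ_γ.
--
-- The chain hanging from a node (t,c,a;k) of the tree is layered over that of
-- (t,c;0), which does not depend on a and k.  Hence for fixed t all chains of
-- nodes (t,a;k) have the same tails (𝒯-tails), and this is the condition on D₀
-- under which the construction can be continued.
--
-- For part (2) let A be uniform of rank α + 1.  Its classes of ρ_α form a locally
-- finite chain with no last element, so they are numbered by ℤ or by ℕ (shape).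
-- An isomorphism of tails preserves ρ_α and therefore the number of classes
-- below a point of the tail.  So A is layered over any class D other than the
-- first (self-layered), and a chain of rank α + 1 with the tails of a uniform
-- chain layered over D is itself layered over D (transfer).  Thus A is D ℤ or
-- D₀ + D ℕ, and by induction D is the chain of some s.  The first class D₀ has
-- the tails of D and the same rank.  Comparing D₀ with D, the same alternative
-- holds for D₀, and so on down to rank ω, with the layers already realized at
-- every stage (realize).  The one chain that need not be realized already is the
-- one met at rank ω; its label is larger than all labels in use, so it can be
-- added to the family.

open import Defs
open import Level using (Level; lift; 0ℓ)
open import Axiom.ExcludedMiddle using (ExcludedMiddle)
open import Data.Empty using (⊥; ⊥-elim)
open import Data.Fin.Base as Fin using (Fin; fromℕ; inject₁; _↑ˡ_)
open import Data.Fin.Relation.Unary.Top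
  using (view; ‵fromℕ; ‵inject₁; view-fromℕ; view-inject₁)
open import Data.Integer.Base as ℤ using (ℤ; +_; -[1+_]; +[1+_]; 0ℤ)
import Data.Integer.Properties as ℤ
open import Data.List.Base using (List; []; _∷_; _++_; map; applyUpTo)
open import Data.List.Relation.Unary.Any as Any using (Any; here; there)
import Data.List.Relation.Unary.Any.Properties as Any
open import Data.Nat.Base as ℕ using (ℕ; zero; suc; z≤n; s≤s)
import Data.Nat.Properties as ℕ
open import Data.Product.Base as × using (Σ-syntax; ∃; ∃-syntax; _×_; _,_; proj₁; proj₂)
open import Data.Sum.Base as ⊎ using (_⊎_; inj₁; inj₂)
open import Data.Sum.Relation.Binary.LeftOrder using (₁∼₂; ₁∼₁; ₂∼₂)
import Data.Sum.Relation.Binary.Pointwise as Pointwise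
open import Data.Unit.Base using (tt)
import Data.Vec.Functional.Properties as Vector
open import Function.Base using (_∘_; id; const)
open import Relation.Binary.Bundles using (TotalOrder; DecTotalOrder)
import Relation.Binary.Construct.On as On
open import Relation.Binary.Core using (Rel)
open import Relation.Binary.Definitions using (tri<; tri≈; tri>)
open import Relation.Binary.Morphism.Structures using (IsOrderIsomorphism)
open import Relation.Binary.PropositionalEquality.Core
  using (_≡_; _≢_; refl; sym; trans; cong; subst; subst₂)
open import Relation.Nullary.Decidable.Core using (yes; no)
open import Relation.Nullary.Negation.Core using (¬_; contradiction)
open import Algebra.Properties.AbelianGroup ℤ.+-0-abelianGroup using (xyx⁻¹≈y)

-- Chains, their embeddings and isomorphisms

module C = TotalOrder

private variable ℓ : Level

Le Eq : (A : Chain ℓ) → Rel ∣ A ∣ ℓ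
Le A = C._≤_ A
Eq A = C._≈_ A

infix 4 Le Eq
syntax Le A x y = x ≤[ A ] y
syntax Eq A x y = x ≈[ A ] y

private variable A B D S T : Chain ℓ
private variable α β γ : Ord ℓ

infix 4 _↪_

-- Order embeddings.  Compatibility with equality follows, because the orders
-- are antisymmetric.

record _↪_ {ℓ} (A B : Chain ℓ) : Set ℓ where
  field
    to     : ∣ A ∣ → ∣ B ∣
    mono   : ∀ {x y} → x ≤[ A ] y → to x ≤[ B ] to y
    cancel : ∀ {x y} → to x ≤[ B ] to y → x ≤[ A ] y

  to-cong : ∀ {x y} → x ≈[ A ] y → to x ≈[ B ] to y
  to-cong p = C.antisym B (mono (C.reflexive A p)) (mono (C.reflexive A (C.Eq.sym A p)))

  injective : ∀ {x y} → to x ≈[ B ] to y → x ≈[ A ] y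
  injective p =
    C.antisym A (cancel (C.reflexive B p)) (cancel (C.reflexive B (C.Eq.sym B p)))

open _↪_

_∘↪_ : B ↪ D → A ↪ B → A ↪ D
f ∘↪ g = record { to = to f ∘ to g ; mono = mono f ∘ mono g ; cancel = cancel g ∘ cancel f }

infix 4 _≃_

-- The relation ≅, as a record in order that its chains be inferred.

record _≃_ {ℓ} (A B : Chain ℓ) : Set ℓ where
  field
    emb  : A ↪ B
    onto : ∀ y → Σ[ x ∈ ∣ A ∣ ] to emb x ≈[ B ] y

  fun : ∣ A ∣ → ∣ B ∣
  fun = to emb

  inv : ∣ B ∣ → ∣ A ∣
  inv y = proj₁ (onto y)

  fun-inv : ∀ y → fun (inv y) ≈[ B ] y
  fun-inv y = proj₂ (onto y)

open _≃_

≃⇒≅ : A ≃ B → A ≅ B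
≃⇒≅ {A = A} {B = B} e = to f , record
  { isOrderMonomorphism = record
    { isOrderHomomorphism = record { cong = to-cong f ; mono = mono f }
    ; injective           = injective f
    ; cancel              = cancel f
    }
  ; surjective = λ y → inv e y , λ p → C.Eq.trans B (to-cong f p) (fun-inv e y)
  }
  where f = emb e

≅⇒≃ : (A B : Chain ℓ) → A ≅ B → A ≃ B
≅⇒≃ A B (f , i) = record
  { emb  = record { to = f ; mono = I.mono ; cancel = I.cancel }
  ; onto = λ y → proj₁ (I.surjective y) , proj₂ (I.surjective y) (C.Eq.refl A)
  }
  where module I = IsOrderIsomorphism i

-- Two chains embedded in a third with the same image are isomorphic.

same-image : (f : S ↪ A) (g : T ↪ A) →
             (∀ s → Σ[ t ∈ ∣ T ∣ ] to f s ≈[ A ] to g t) →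
             (∀ t → Σ[ s ∈ ∣ S ∣ ] to f s ≈[ A ] to g t) → S ≃ T
same-image {A = A} f g p q = record
  { emb = record
    { to     = λ s → proj₁ (p s)
    ; mono   = λ {x} {y} x≤y → cancel g
        (A.trans (A.reflexive (A.Eq.sym (proj₂ (p x))))
                 (A.trans (mono f x≤y) (A.reflexive (proj₂ (p y)))))
    ; cancel = λ {x} {y} x≤y → cancel f
        (A.trans (A.reflexive (proj₂ (p x)))
                 (A.trans (mono g x≤y) (A.reflexive (A.Eq.sym (proj₂ (p y))))))
    }
  ; onto = λ t → proj₁ (q t) ,
      injective g (A.Eq.trans (A.Eq.sym (proj₂ (p (proj₁ (q t))))) (proj₂ (q t)))
  }
  where module A = TotalOrder A

id↪ : A ↪ A
id↪ = record { to = id ; mono = id ; cancel = id }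

≃-refl : A ≃ A
≃-refl {A = A} = record { emb = id↪ ; onto = λ x → x , C.Eq.refl A }

≃-sym : A ≃ B → B ≃ A
≃-sym {A = A} {B = B} e =
  same-image {A = B} id↪ (emb e)
    (λ y → inv e y , C.Eq.sym B (fun-inv e y))
    (λ x → fun e x , C.Eq.refl B)

≃-trans : A ≃ B → B ≃ D → A ≃ D
≃-trans {D = D} e f = record
  { emb  = emb f ∘↪ emb e
  ; onto = λ z → inv e (inv f z) ,
      C.Eq.trans D (to-cong (emb f) (fun-inv e (inv f z))) (fun-inv f z)
  }

≡⇒≃ : A ≡ B → A ≃ B
≡⇒≃ refl = ≃-refl

inv-fun : (e : A ≃ B) (x : ∣ A ∣) → inv e (fun e x) ≈[ A ] x
inv-fun e x = injective (emb e) (fun-inv e (fun e x))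

-- Tails

tail↪ : (A : Chain ℓ) (x : ∣ A ∣) → A ^≥ x ↪ A
tail↪ A x = record { to = proj₁ ; mono = id ; cancel = id }

-- The relation SameTail, as a record in order that its chains be inferred.

record Tails {ℓ} (A B : Chain ℓ) : Set ℓ where
  constructor tails
  field tail : ∀ x y → A ^≥ x ≃ B ^≥ y

open Tails

Tails⇒ : Tails A B → SameTail A B
Tails⇒ t x y = ≃⇒≅ (tail t x y)

⇒Tails : (A B : Chain ℓ) → SameTail A B → Tails A B
⇒Tails A B t = tails λ x y → ≅⇒≃ (A ^≥ x) (B ^≥ y) (t x y)

Tails-sym : Tails A B → Tails B A
Tails-sym t = tails λ x y → ≃-sym (tail t y x)

Tails-trans : ∣ B ∣ → Tails A B → Tails B D → Tails A D
Tails-trans b t u = tails λ x y → ≃-trans (tail t x b) (tail u b y)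

-- An isomorphism carries the tail at an element to the tail at its image.

≃-tail : (e : A ≃ B) {x : ∣ A ∣} {y : ∣ B ∣} → fun e x ≈[ B ] y → A ^≥ x ≃ B ^≥ y
≃-tail {A = A} {B = B} e {x} {y} p =
  same-image {A = B} (emb e ∘↪ tail↪ A x) (tail↪ B y)
    (λ (u , x≤u) → (fun e u , B.trans (B.reflexive (B.Eq.sym p)) (mono (emb e) x≤u)) , B.Eq.refl)
    (λ (v , y≤v) →
      ( inv e v
      , cancel (emb e)
          (B.trans (B.reflexive p) (B.trans y≤v (B.reflexive (B.Eq.sym (fun-inv e v))))))
      , fun-inv e v)
  where module B = TotalOrder B

Tails-≃ʳ : Tails A B → B ≃ D → Tails A D
Tails-≃ʳ {D = D} t e = tails λ x y → ≃-trans (tail t x (inv e y)) (≃-tail e (fun-inv e y))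

Tails-≃ˡ : A ≃ B → Tails A D → Tails B D
Tails-≃ˡ e t = Tails-sym (Tails-≃ʳ (Tails-sym t) e)

-- The order of the ordinals

≤ₒ-refl : α ≤ₒ α
≤ₒ-refl {α = zero}     = zero≤
≤ₒ-refl {α = suc α}    = suc≤suc ≤ₒ-refl
≤ₒ-refl {α = lim i₀ f} = lim≤ λ i → ≤lim i ≤ₒ-refl

≤ₒ-trans : α ≤ₒ β → β ≤ₒ γ → α ≤ₒ γ
≤ₒ-trans zero≤       q           = zero≤
≤ₒ-trans (lim≤ p)    q           = lim≤ λ i → ≤ₒ-trans (p i) q
≤ₒ-trans (≤lim i p)  (lim≤ q)    = ≤ₒ-trans p (q i)
≤ₒ-trans (suc≤suc p) (suc≤suc q) = suc≤suc (≤ₒ-trans p q)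
≤ₒ-trans p@(suc≤suc _) (≤lim i q) = ≤lim i (≤ₒ-trans p q)
≤ₒ-trans p@(≤lim _ _)  (≤lim i q) = ≤lim i (≤ₒ-trans p q)

suc≤suc⁻¹ : suc α ≤ₒ suc β → α ≤ₒ β
suc≤suc⁻¹ (suc≤suc p) = p

α≤1+α : α ≤ₒ suc α
α≤1+α {α = zero}     = zero≤
α≤1+α {α = suc α}    = suc≤suc α≤1+α
α≤1+α {α = lim i₀ f} = lim≤ λ i → ≤ₒ-trans α≤1+α (suc≤suc (≤lim i ≤ₒ-refl))

-- The condensations ρ

module _ (A : Chain ℓ) where
  private module A = TotalOrder A

  -- z lies between x and y, in either order.

  Between : ∣ A ∣ → ∣ A ∣ → ∣ A ∣ → Set ℓ
  Between = Interval (raw A)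

  -- The interval of x and y in A meets finitely many classes of ρ A α.

  FinitelyMany : Ord ℓ → ∣ A ∣ → ∣ A ∣ → Set ℓ
  FinitelyMany α x y = Σ[ zs ∈ List ∣ A ∣ ] (∀ z → Between x y z → Any (ρ A α z) zs)

  ρ-sym : ∀ α {x y} → ρ A α x y → ρ A α y x
  ρ-sym zero       p        = A.Eq.sym p
  ρ-sym (suc α)    (zs , c) = zs , λ z → c z ∘ ⊎.swap
  ρ-sym (lim i₀ f) (i , p)  = i , ρ-sym (f i) p

  -- A point between x and y in the quotient lies between them in A unless it is
  -- related to one of them.  So ρ A (suc α) can be defined by intervals of A.

  finitelyMany⇒ρ : ∀ α {x y} → FinitelyMany α x y → ρ A (suc α) x y
  finitelyMany⇒ρ α {x} {y} (zs , c) = x ∷ y ∷ zs , λ where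
    z (inj₁ (inj₁ x≤z , inj₁ z≤y)) → there (there (c z (inj₁ (x≤z , z≤y))))
    z (inj₂ (inj₁ y≤z , inj₁ z≤x)) → there (there (c z (inj₂ (y≤z , z≤x))))
    z (inj₁ (inj₂ xρz , _))        → here (ρ-sym α xρz)
    z (inj₁ (_ , inj₂ zρy))        → there (here zρy)
    z (inj₂ (inj₂ yρz , _))        → there (here (ρ-sym α yρz))
    z (inj₂ (_ , inj₂ zρx))        → here zρx

  ρ⇒finitelyMany : ∀ α {x y} → ρ A (suc α) x y → FinitelyMany α x y
  ρ⇒finitelyMany α (zs , c) = zs , λ z → c z ∘ ⊎.map (×.map inj₁ inj₁) (×.map inj₁ inj₁)

  between-≈ : ∀ {x y z} → x ≈[ A ] y → Between x y z → z ≈[ A ] x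
  between-≈ x≈y (inj₁ (x≤z , z≤y)) =
    A.antisym (A.trans z≤y (A.reflexive (A.Eq.sym x≈y))) x≤z
  between-≈ x≈y (inj₂ (y≤z , z≤x)) = A.antisym z≤x (A.trans (A.reflexive x≈y) y≤z)

  ρ-reflexive : ∀ α {x y} → x ≈[ A ] y → ρ A α x y
  ρ-reflexive zero       p = p
  ρ-reflexive (suc α) {x} p =
    finitelyMany⇒ρ α (x ∷ [] , λ z b → here (ρ-reflexive α (between-≈ p b)))
  ρ-reflexive (lim i₀ f) p = i₀ , ρ-reflexive (f i₀) p

  ρ-refl : ∀ α {x} → ρ A α x x
  ρ-refl α = ρ-reflexive α A.Eq.refl

  between-shrink : ∀ {x y z w} → Between x y z → Between x z w → Between x y w
  between-shrink (inj₁ (x≤z , z≤y)) (inj₁ (x≤w , w≤z)) = inj₁ (x≤w , A.trans w≤z z≤y)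
  between-shrink (inj₁ (x≤z , z≤y)) (inj₂ (z≤w , w≤x)) =
    inj₁ (A.trans x≤z z≤w , A.trans w≤x (A.trans x≤z z≤y))
  between-shrink (inj₂ (y≤z , z≤x)) (inj₁ (x≤w , w≤z)) =
    inj₂ (A.trans y≤z (A.trans z≤x x≤w) , A.trans w≤z z≤x)
  between-shrink (inj₂ (y≤z , z≤x)) (inj₂ (z≤w , w≤x)) = inj₂ (A.trans y≤z z≤w , w≤x)

  between-split : ∀ {x z w} y → Between x z w → Between x y w ⊎ Between y z w
  between-split {w = w} y (inj₁ (x≤w , w≤z)) with A.total w y
  ... | inj₁ w≤y = inj₁ (inj₁ (x≤w , w≤y))
  ... | inj₂ y≤w = inj₂ (inj₁ (y≤w , w≤z))
  between-split {w = w} y (inj₂ (z≤w , w≤x)) with A.total w y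
  ... | inj₁ w≤y = inj₂ (inj₂ (z≤w , w≤y))
  ... | inj₂ y≤w = inj₁ (inj₂ (y≤w , w≤x))

  ρ-convex : ∀ α {x y z} → Between x y z → ρ A α x y → ρ A α x z
  ρ-convex zero       b p       = A.Eq.sym (between-≈ p b)
  ρ-convex (suc α)    b p with ρ⇒finitelyMany α p
  ... | zs , c = finitelyMany⇒ρ α (zs , λ w b′ → c w (between-shrink b b′))
  ρ-convex (lim i₀ f) b (i , p) = i , ρ-convex (f i) b p

  ρ-mono : α ≤ₒ β → ∀ {x y} → ρ A α x y → ρ A β x y
  ρ-mono {β = β} zero≤                        p       = ρ-reflexive β p
  ρ-mono         (suc≤suc {α} {β} α≤β)        p with ρ⇒finitelyMany α p
  ... | zs , c = finitelyMany⇒ρ β (zs , λ z b → Any.map (ρ-mono α≤β) (c z b))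
  ρ-mono         (≤lim i α≤fi)                p       = i , ρ-mono α≤fi p
  ρ-mono         (lim≤ f≤β)                   (i , p) = ρ-mono (f≤β i) p

module _ (em : ∀ {ℓ′ : Level} → ExcludedMiddle ℓ′) where

  by-contradiction : ∀ {p} {P : Set p} → ¬ ¬ P → P
  by-contradiction {P = P} ¬¬p with em {P = P}
  ... | yes p = p
  ... | no ¬p = contradiction ¬p ¬¬p

  ≤ₒ-or-> : (α β : Ord ℓ) → α ≤ₒ β ⊎ β <ₒ α
  ≤ₒ-or-> zero β = inj₁ zero≤
  ≤ₒ-or-> (lim {I} i₀ f) β with em {P = Σ[ i ∈ I ] β <ₒ f i}
  ... | yes (i , p) = inj₂ (≤lim i p)
  ... | no ¬p = inj₁ (lim≤ λ i → ⊎.[ id , (λ q → ⊥-elim (¬p (i , q))) ]′ (≤ₒ-or-> (f i) β))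
  ≤ₒ-or-> (suc α) zero = inj₂ (suc≤suc zero≤)
  ≤ₒ-or-> (suc α) (suc β) = ⊎.map suc≤suc suc≤suc (≤ₒ-or-> α β)
  ≤ₒ-or-> (suc α) (lim {J} j₀ g) with em {P = Σ[ j ∈ J ] suc α ≤ₒ g j}
  ... | yes (j , p) = inj₁ (≤lim j p)
  ... | no ¬p = inj₂ (suc≤suc (lim≤ λ j →
          ⊎.[ (λ q → ⊥-elim (¬p (j , q))) , suc≤suc⁻¹ ]′ (≤ₒ-or-> (suc α) (g j))))

  -- At a limit, two members of the family are compared, because the family is
  -- not assumed to be increasing or directed.

  ρ-trans : (A : Chain ℓ) → ∀ α {x y z} → ρ A α x y → ρ A α y z → ρ A α x z
  ρ-trans A zero    p q = C.Eq.trans A p q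
  ρ-trans A (suc α) {x} {y} {z} p q with ρ⇒finitelyMany A α p | ρ⇒finitelyMany A α q
  ... | us , c | vs , d = finitelyMany⇒ρ A α (us ++ vs , λ w b →
          ⊎.[ Any.++⁺ˡ ∘ c w , Any.++⁺ʳ us ∘ d w ]′ (between-split A y b))
  ρ-trans A (lim i₀ f) (i , p) (j , q) with ≤ₒ-or-> (f i) (f j)
  ... | inj₁ fi≤fj = j , ρ-trans A (f j) (ρ-mono A fi≤fj p) q
  ... | inj₂ fj<fi = i , ρ-trans A (f i) p (ρ-mono A (≤ₒ-trans α≤1+α fj<fi) q)

  -- Condensations of convex subchains

  -- The image of f is convex.

  Convex : A ↪ B → Set _
  Convex {A = A} {B = B} f =
    ∀ x y {z} → to f x ≤[ B ] z → z ≤[ B ] to f y → Σ[ w ∈ ∣ A ∣ ] to f w ≈[ B ] z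

  -- Makes a cover by points of Y into a cover by images of points of X: members
  -- of the list related to an image are replaced by the preimage, and the others
  -- are dropped.

  pull-back : ∀ {a b r} {X : Set a} {Y : Set b} (R : Y → Y → Set r) (f : X → Y) →
              (∀ {x y z} → R x z → R y z → R x y) → (zs : List Y) →
              Σ[ ws ∈ List X ] (∀ x → Any (R (f x)) zs → Any (λ w → R (f x) (f w)) ws)
  pull-back R f join [] = [] , λ x ()
  pull-back R f join (z ∷ zs) with pull-back R f join zs | em {P = ∃[ w ] R (f w) z}
  ... | ws , c | yes (w , p) = w ∷ ws , λ where
        x (here q)  → here (join q p)
        x (there q) → there (c x q)
  ... | ws , c | no ¬p = ws , λ where
        x (here q)  → ⊥-elim (¬p (x , q))
        x (there q) → c x q

  -- ρ A α is the restriction of ρ B α to a convex subchain A of B.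

  module _ (f : A ↪ B) (convex : Convex f) where

    ρ-push : ∀ α {x y} → ρ A α x y → ρ B α (to f x) (to f y)
    ρ-pull : ∀ α {x y} → ρ B α (to f x) (to f y) → ρ A α x y

    ρ-push zero    p = to-cong f p
    ρ-push (suc α) {x} {y} p with ρ⇒finitelyMany A α p
    ... | zs , c = finitelyMany⇒ρ B α (map (to f) zs , cover)
      where
      cover : ∀ z → Between B (to f x) (to f y) z → Any (ρ B α z) (map (to f) zs)
      cover z b = Any.map⁺ (Any.map (λ q → ρ-trans B α (ρ-reflexive B α (C.Eq.sym B w≈z))
                                                       (ρ-push α q))
                                    (c w (inside b)))
        where
        preimage : Between B (to f x) (to f y) z → Σ[ w ∈ ∣ A ∣ ] to f w ≈[ B ] z
        preimage (inj₁ (p , q)) = convex _ _ p q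
        preimage (inj₂ (p , q)) = convex _ _ p q
        w : ∣ A ∣
        w = proj₁ (preimage b)
        w≈z : to f w ≈[ B ] z
        w≈z = proj₂ (preimage b)
        below : ∀ {u} → to f u ≤[ B ] z → u ≤[ A ] w
        below p = cancel f (C.trans B p (C.reflexive B (C.Eq.sym B w≈z)))
        above : ∀ {u} → z ≤[ B ] to f u → w ≤[ A ] u
        above p = cancel f (C.trans B (C.reflexive B w≈z) p)
        inside : Between B (to f x) (to f y) z → Between A x y w
        inside = ⊎.map (×.map below above) (×.map below above)
    ρ-push (lim i₀ g) (i , p) = i , ρ-push (g i) p

    ρ-pull zero    p = injective f p
    ρ-pull (suc α) {x} {y} p with ρ⇒finitelyMany B α p
    ... | zs , c with pull-back (ρ B α) (to f) (λ q r → ρ-trans B α q (ρ-sym B α r)) zs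
    ... | ws , d = finitelyMany⇒ρ A α (ws , λ z b → Any.map (ρ-pull α) (d z (c (to f z) (image b))))
      where
      image : ∀ {z} → Between A x y z → Between B (to f x) (to f y) (to f z)
      image = ⊎.map (×.map (mono f) (mono f)) (×.map (mono f) (mono f))
    ρ-pull (lim i₀ g) (i , p) = i , ρ-pull (g i) p

  ≃-convex : (e : A ≃ B) → Convex (emb e)
  ≃-convex e _ _ {z} _ _ = onto e z

  tail-convex : (A : Chain ℓ) (x : ∣ A ∣) → Convex (tail↪ A x)
  tail-convex A x (_ , x≤u) _ {z} u≤z _ = (z , C.trans A x≤u u≤z) , C.Eq.refl A

  -- Tails and rank

  -- Any two elements of A are related, so that A / α is the one-element chain if
  -- A is nonempty.

  record Collapsed {ℓ} (A : Chain ℓ) (α : Ord ℓ) : Set ℓ where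
    constructor collapse
    field related : ∀ x y → ρ A α x y

  open Collapsed

  Collapsed-≃ : A ≃ B → Collapsed A α → Collapsed B α
  Collapsed-≃ {α = α} e c = collapse λ x y →
    ρ-pull (emb (≃-sym e)) (≃-convex (≃-sym e)) α (related c _ _)

  Collapsed-tail : ∀ x → Collapsed A α → Collapsed (A ^≥ x) α
  Collapsed-tail {A = A} {α = α} x c = collapse λ u v →
    ρ-pull (tail↪ A x) (tail-convex A x) α (related c _ _)

  -- If A and B have the same tails, and one tail of A is collapsed, then so is
  -- every tail of B, and hence B.

  spread : Tails A B → (x : ∣ A ∣) → Collapsed (A ^≥ x) α → Collapsed B α
  spread {A = A} {B = B} {α = α} t x c = collapse rel
    where
    rel : ∀ u v → ρ B α u v
    rel u v with C.total B u v
    ... | inj₁ u≤v = ρ-push (tail↪ B u) (tail-convex B u) α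
                       (related (Collapsed-≃ (tail t x u) c) (u , C.refl B) (v , u≤v))
    ... | inj₂ v≤u = ρ-push (tail↪ B v) (tail-convex B v) α
                       (related (Collapsed-≃ (tail t x v) c) (u , v≤u) (v , C.refl B))

  Collapsed-Tails : Tails A B → ∣ A ∣ → Collapsed A α → Collapsed B α
  Collapsed-Tails t x c = spread t x (Collapsed-tail x c)

  -- The relation HasRank, with A / α ≅ 𝟙 replaced by its meaning.

  record Rank {ℓ} (A : Chain ℓ) (α : Ord ℓ) : Set (Level.suc ℓ) where
    field
      point     : ∣ A ∣
      collapsed : Collapsed A α
      minimal   : ∀ β → β <ₒ α → ¬ Collapsed A β

  open Rank

  trivial⇒ : A / α ≅ʳ 𝟙 → ∣ A ∣ × Collapsed A α
  trivial⇒ (f , i) = proj₁ (surjective tt) , collapse λ x y → injective′ refl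
    where open IsOrderIsomorphism i renaming (injective to injective′)

  ⇒trivial : ∣ A ∣ → Collapsed A α → A / α ≅ʳ 𝟙
  ⇒trivial x c = (λ _ → tt) , record
    { isOrderMonomorphism = record
      { isOrderHomomorphism = record { cong = λ _ → refl ; mono = λ _ → refl }
      ; injective           = λ _ → related c _ _
      ; cancel              = λ _ → inj₂ (related c _ _)
      }
    ; surjective = λ _ → x , λ _ → refl
    }

  HasRank⇒Rank : HasRank A α → Rank A α
  HasRank⇒Rank {A = A} {α = α} (t , m) = record
    { point     = proj₁ (trivial⇒ {A = A} {α = α} t)
    ; collapsed = proj₂ (trivial⇒ {A = A} {α = α} t)
    ; minimal   = λ β β<α c →
        m β β<α (⇒trivial {A = A} {α = β} (proj₁ (trivial⇒ {A = A} {α = α} t)) c)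
    }

  Rank⇒HasRank : Rank A α → HasRank A α
  Rank⇒HasRank {A = A} {α = α} r =
    ⇒trivial {A = A} {α = α} (point r) (collapsed r) ,
    λ β β<α t → minimal r β β<α (proj₂ (trivial⇒ {A = A} {α = β} t))

  Rank-Tails : ∣ B ∣ → Tails A B → Rank A α → Rank B α
  Rank-Tails y t r = record
    { point     = y
    ; collapsed = Collapsed-Tails t (point r) (collapsed r)
    ; minimal   = λ β β<α c → minimal r β β<α (Collapsed-Tails (Tails-sym t) y c)
    }

  Rank-≃ : A ≃ B → Rank A α → Rank B α
  Rank-≃ e r = record
    { point     = fun e (point r)
    ; collapsed = Collapsed-≃ e (collapsed r)
    ; minimal   = λ β β<α c → minimal r β β<α (Collapsed-≃ (≃-sym e) c)
    }

  Rank-suc : ∣ A ∣ → Collapsed A (suc α) → ¬ Collapsed A α → Rank A (suc α)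
  Rank-suc {A = A} x c ¬c = record
    { point     = x
    ; collapsed = c
    ; minimal   = λ β β<1+α d → ¬c (collapse λ u v → ρ-mono A (suc≤suc⁻¹ β<1+α) (related d u v))
    }

  -- Gradings

  offset : ∀ i j {k} → i ≡ j ℤ.+ k → i ℤ.- j ≡ k
  offset i j {k} refl = xyx⁻¹≈y j k

  offset⁻¹ : ∀ i j {k} → i ℤ.- j ≡ k → i ≡ j ℤ.+ k
  offset⁻¹ i j refl = trans (sym (xyx⁻¹≈y j i)) (ℤ.+-assoc j i (ℤ.- j))

  i<i+1+m : ∀ i m → i ℤ.< i ℤ.+ +[1+ m ]
  i<i+1+m i m = subst (ℤ._< i ℤ.+ +[1+ m ]) (ℤ.+-identityʳ i) (ℤ.+-monoʳ-< i (ℤ.+<+ ℕ.z<s))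

  1+[i+m] : ∀ i m → ℤ.suc (i ℤ.+ + m) ≡ i ℤ.+ +[1+ m ]
  1+[i+m] i m = trans (ℤ.+-comm ℤ.1ℤ (i ℤ.+ + m))
    (trans (ℤ.+-assoc i (+ m) ℤ.1ℤ) (cong (λ k → i ℤ.+ + k) (ℕ.+-comm m 1)))

  i+m≤i+n⇒m≤n : ∀ i {m n} → i ℤ.+ + m ℤ.≤ i ℤ.+ + n → m ℕ.≤ n
  i+m≤i+n⇒m≤n i p = ℕ.≮⇒≥ λ n<m → ℤ.<⇒≱ (ℤ.+-monoʳ-< i (ℤ.+<+ n<m)) p

  -- A monotone map to the integers.  It exhibits A as the ordered sum of its
  -- fibres, some of which may be empty.

  record Grading {ℓ} (A : Chain ℓ) : Set ℓ where
    field
      π      : ∣ A ∣ → ℤ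
      π-mono : ∀ {x y} → x ≤[ A ] y → π x ℤ.≤ π y

    π-cong : ∀ {x y} → x ≈[ A ] y → π x ≡ π y
    π-cong p = ℤ.≤-antisym (π-mono (C.reflexive A p)) (π-mono (C.reflexive A (C.Eq.sym A p)))

    π<⇒≤ : ∀ {x y} → π x ℤ.< π y → x ≤[ A ] y
    π<⇒≤ {x} {y} p with C.total A x y
    ... | inj₁ x≤y = x≤y
    ... | inj₂ y≤x = contradiction (π-mono y≤x) (ℤ.<⇒≱ p)

  open Grading

  -- The fibre of the grading over i.

  Fib : Grading A → ℤ → Chain _
  Fib {A = A} g i = On.totalOrder A (proj₁ {B = λ x → π g x ≡ i})

  fib↪ : (g : Grading A) (i : ℤ) → Fib g i ↪ A
  fib↪ g i = record { to = proj₁ ; mono = id ; cancel = id }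

  fib-convex : (g : Grading A) (i : ℤ) → Convex (fib↪ g i)
  fib-convex {A = A} g i (x , πx≡i) (y , πy≡i) {z} x≤z z≤y =
    (z , ℤ.≤-antisym (subst (π g z ℤ.≤_) πy≡i (π-mono g z≤y))
                     (subst (ℤ._≤ π g z) πx≡i (π-mono g x≤z)))
    , C.Eq.refl A

  distance : (g : Grading A) {x y : ∣ A ∣} → x ≤[ A ] y → ∃[ m ] π g y ≡ π g x ℤ.+ + m
  distance g {x} {y} x≤y = ℤ.∣ π g y ℤ.- π g x ∣ ,
    offset⁻¹ (π g y) (π g x) (sym (ℤ.0≤i⇒+∣i∣≡i (ℤ.i≤j⇒0≤j-i (π-mono g x≤y))))

  module Glue (g : Grading A) (h : Grading B) (e : ∀ i → Fib g i ≃ Fib h i) where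
    private
      module A = TotalOrder A
      module B = TotalOrder B

      f : ∣ A ∣ → ∣ B ∣
      f x = proj₁ (fun (e (π g x)) (x , refl))

      π-f : ∀ x → π h (f x) ≡ π g x
      π-f x = proj₂ (fun (e (π g x)) (x , refl))

      f-fib : ∀ {i} x (p : π g x ≡ i) → f x ≡ proj₁ (fun (e i) (x , p))
      f-fib x refl = refl

      f-mono : ∀ {x y} → x A.≤ y → f x B.≤ f y
      f-mono {x} {y} x≤y with π g x ℤ.≟ π g y
      ... | yes p rewrite f-fib x p = mono (emb (e (π g y))) x≤y
      ... | no πx≢πy with B.total (f x) (f y)
      ...   | inj₁ fx≤fy = fx≤fy
      ...   | inj₂ fy≤fx = contradiction (ℤ.≤-antisym (π-mono g x≤y)
                (subst (ℤ._≤ π g x) (π-f y) (subst (π h (f y) ℤ.≤_) (π-f x) (π-mono h fy≤fx))))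
                πx≢πy

      f-cancel : ∀ {x y} → f x B.≤ f y → x A.≤ y
      f-cancel {x} {y} fx≤fy with π g x ℤ.≟ π g y
      ... | yes p = cancel (emb (e (π g y))) {x , p} {y , refl}
                      (subst (B._≤ f y) (f-fib x p) fx≤fy)
      ... | no πx≢πy with A.total x y
      ...   | inj₁ x≤y = x≤y
      ...   | inj₂ y≤x = contradiction (ℤ.≤-antisym
                (subst (ℤ._≤ π g y) (π-f x) (subst (π h (f x) ℤ.≤_) (π-f y) (π-mono h fx≤fy)))
                (π-mono g y≤x)) πx≢πy

      f-onto : ∀ y → Σ[ x ∈ ∣ A ∣ ] f x B.≈ y
      f-onto y with onto (e (π h y)) (y , refl)
      ... | (x , p) , q = x , subst (B._≈ y) (sym (f-fib x p)) q

    glue : A ≃ B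
    glue = record
      { emb  = record { to = f ; mono = f-mono ; cancel = f-cancel }
      ; onto = f-onto
      }

  open Glue using (glue)

  -- The tail at x, graded by the distance from the fibre of x.

  tail-grading : (g : Grading A) (x : ∣ A ∣) → Grading (A ^≥ x)
  tail-grading g x = record
    { π      = λ (u , _) → π g u ℤ.- π g x
    ; π-mono = λ u≤v → ℤ.+-monoˡ-≤ (ℤ.- π g x) (π-mono g u≤v)
    }

  module _ {A : Chain ℓ} (g : Grading A) (x : ∣ A ∣) where

    first-fib : Fib (tail-grading g x) 0ℤ ≃ Fib g (π g x) ^≥ (x , refl)
    first-fib = same-image {A = A} (tail↪ A x ∘↪ fib↪ (tail-grading g x) 0ℤ)
                  (fib↪ g (π g x) ∘↪ tail↪ (Fib g (π g x)) (x , refl))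
      (λ ((u , x≤u) , p) → ((u , ℤ.i-j≡0⇒i≡j (π g u) (π g x) p) , x≤u) , C.Eq.refl A)
      (λ ((u , p) , x≤u) → ((u , x≤u) , ℤ.i≡j⇒i-j≡0 p) , C.Eq.refl A)

    later-fib : ∀ m → Fib (tail-grading g x) +[1+ m ] ≃ Fib g (π g x ℤ.+ +[1+ m ])
    later-fib m = same-image {A = A} (tail↪ A x ∘↪ fib↪ (tail-grading g x) +[1+ m ])
                    (fib↪ g (π g x ℤ.+ +[1+ m ]))
      (λ ((u , x≤u) , p) → (u , offset⁻¹ (π g u) (π g x) p) , C.Eq.refl A)
      (λ (u , p) → ((u , π<⇒≤ g (subst (π g x ℤ.<_) (sym p) (i<i+1+m (π g x) m)))
                   , offset (π g u) (π g x) p) , C.Eq.refl A)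

    no-earlier-fib : ∀ m → ¬ ∣ Fib (tail-grading g x) -[1+ m ] ∣
    no-earlier-fib m ((u , x≤u) , p) with subst (0ℤ ℤ.≤_) p (ℤ.i≤j⇒0≤j-i (π-mono g x≤u))
    ... | ()

  empty-≃ : ¬ ∣ A ∣ → ¬ ∣ B ∣ → A ≃ B
  empty-≃ ¬a ¬b = record
    { emb  = record
      { to     = ⊥-elim ∘ ¬a
      ; mono   = λ {x} _ → ⊥-elim (¬a x)
      ; cancel = λ {x} _ → ⊥-elim (¬a x)
      }
    ; onto = ⊥-elim ∘ ¬b
    }

  tail-glue : (g : Grading A) (h : Grading B) (x : ∣ A ∣) (y : ∣ B ∣) →
              Fib g (π g x) ^≥ (x , refl) ≃ Fib h (π h y) ^≥ (y , refl) →
              (∀ m → Fib g (π g x ℤ.+ +[1+ m ]) ≃ Fib h (π h y ℤ.+ +[1+ m ])) →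
              A ^≥ x ≃ B ^≥ y
  tail-glue g h x y e₀ e = glue (tail-grading g x) (tail-grading h y) λ where
    (+ zero)  → ≃-trans (first-fib g x) (≃-trans e₀ (≃-sym (first-fib h y)))
    +[1+ m ]  → ≃-trans (later-fib g x m) (≃-trans (e m) (≃-sym (later-fib h y m)))
    -[1+ m ]  → empty-≃ (no-earlier-fib g x m) (no-earlier-fib h y m)

  -- Layered chains

  -- A grading of A in which every fibre has the tails of D, and every fibre
  -- above a nonempty one is a copy of D.

  record Layered {ℓ} (A D : Chain ℓ) : Set ℓ where
    field
      layers    : Grading A
      fib-tails : ∀ i → Tails (Fib layers i) D
      fib-above : ∀ x m → Fib layers (π layers x ℤ.+ +[1+ m ]) ≃ D

  open Layered

  Layered-≃ : Layered A B → B ≃ D → Layered A D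
  Layered-≃ L e = record
    { layers    = layers L
    ; fib-tails = λ i → Tails-≃ʳ (fib-tails L i) e
    ; fib-above = λ x m → ≃-trans (fib-above L x m) e
    }

  Layered-Tails : ∣ D ∣ → Layered A D → Layered B D → Tails A B
  Layered-Tails d L M = tails λ x y → tail-glue (layers L) (layers M) x y
    (≃-trans (tail (fib-tails L _) (x , refl) d) (≃-sym (tail (fib-tails M _) (y , refl) d)))
    (λ m → ≃-trans (fib-above L x m) (≃-sym (fib-above M y m)))

  -- Products with ℤ and sums with products with ℕ

  -- The copy of A with index i in A ⊗ I.

  copy : (I : DecTotalOrder 0ℓ 0ℓ 0ℓ) → DecTotalOrder.Carrier I → A ↪ A ⊗ I
  copy I i = record
    { to     = i ,_
    ; mono   = λ p → inj₂ (DecTotalOrder.Eq.refl I , p)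
    ; cancel = λ where
        (inj₁ (_ , i≉i)) → ⊥-elim (i≉i (DecTotalOrder.Eq.refl I))
        (inj₂ (_ , p))   → p
    }

  inl : A ↪ A ⊕ B
  inl = record { to = inj₁ ; mono = ₁∼₁ ; cancel = λ { (₁∼₁ p) → p } }

  inr : B ↪ A ⊕ B
  inr = record { to = inj₂ ; mono = ₂∼₂ ; cancel = λ { (₂∼₂ p) → p } }

  ⊗ℤ-grading : Grading (A ⊗ ℤᶜ)
  ⊗ℤ-grading = record
    { π      = proj₁
    ; π-mono = λ { (inj₁ (i≤j , _)) → i≤j ; (inj₂ (i≡j , _)) → ℤ.≤-reflexive i≡j }
    }

  ⊗ℤ-fib : ∀ i → Fib (⊗ℤ-grading {A = A}) i ≃ A
  ⊗ℤ-fib {A = A} i = same-image {A = A ⊗ ℤᶜ} (fib↪ ⊗ℤ-grading i) (copy ℤᶜ i)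
    (λ ((_ , x) , p) → x , p , C.Eq.refl A)
    (λ x → ((i , x) , refl) , refl , C.Eq.refl A)

  ⊗ℤ-layered : Tails A A → Layered (A ⊗ ℤᶜ) A
  ⊗ℤ-layered u = record
    { layers    = ⊗ℤ-grading
    ; fib-tails = λ i → Tails-≃ˡ (≃-sym (⊗ℤ-fib i)) u
    ; fib-above = λ x m → ⊗ℤ-fib _
    }

  -- The first summand is the fibre over 0, and the copy of B with index m is the
  -- fibre over 1 + m.

  ⊕ℕ-grading : Grading (A ⊕ B ⊗ ℕᶜ)
  ⊕ℕ-grading = record
    { π      = ⊎.[ const 0ℤ , (λ (i , _) → +[1+ i ]) ]′
    ; π-mono = λ where
        ₁∼₂                     → ℤ.+≤+ z≤n
        (₁∼₁ _)                 → ℤ.≤-refl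
        (₂∼₂ (inj₁ (i≤j , _)))  → ℤ.+≤+ (s≤s i≤j)
        (₂∼₂ (inj₂ (refl , _))) → ℤ.≤-refl
    }

  ⊕ℕ-fib-zero : Fib (⊕ℕ-grading {A = A} {B = B}) 0ℤ ≃ A
  ⊕ℕ-fib-zero {A = A} {B = B} = same-image {A = A ⊕ B ⊗ ℕᶜ} (fib↪ ⊕ℕ-grading 0ℤ) inl
    (λ { (inj₁ x , _) → x , C.Eq.refl (A ⊕ B ⊗ ℕᶜ) })
    (λ x → (inj₁ x , refl) , C.Eq.refl (A ⊕ B ⊗ ℕᶜ))

  ⊕ℕ-fib-suc : ∀ m → Fib (⊕ℕ-grading {A = A} {B = B}) +[1+ m ] ≃ B
  ⊕ℕ-fib-suc {A = A} {B = B} m =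
    same-image {A = A ⊕ B ⊗ ℕᶜ} (fib↪ ⊕ℕ-grading +[1+ m ]) (inr ∘↪ copy ℕᶜ m)
      (λ { (inj₂ (_ , x) , refl) → x , C.Eq.refl (A ⊕ B ⊗ ℕᶜ) })
      (λ x → (inj₂ (m , x) , refl) , C.Eq.refl (A ⊕ B ⊗ ℕᶜ))

  ⊕ℕ-no-fib : ∀ m → ¬ ∣ Fib (⊕ℕ-grading {A = A} {B = B}) -[1+ m ] ∣
  ⊕ℕ-no-fib m (inj₁ _ , ())
  ⊕ℕ-no-fib m (inj₂ _ , ())

  ⊕ℕ-layered : Tails A B → Tails B B → Layered (A ⊕ B ⊗ ℕᶜ) B
  ⊕ℕ-layered {A = A} {B = B} t u = record
    { layers    = ⊕ℕ-grading
    ; fib-tails = λ where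
        (+ zero)  → Tails-≃ˡ (≃-sym ⊕ℕ-fib-zero) t
        +[1+ m ]  → Tails-≃ˡ (≃-sym (⊕ℕ-fib-suc {A = A} m)) u
        -[1+ m ]  → tails λ x → ⊥-elim (⊕ℕ-no-fib {A = A} {B = B} m x)
    ; fib-above = λ where
        (inj₁ x)       m → ⊕ℕ-fib-suc m
        (inj₂ (i , x)) m → ⊕ℕ-fib-suc _
    }

  ⊗-cong : (I : DecTotalOrder 0ℓ 0ℓ 0ℓ) → A ≃ B → A ⊗ I ≃ B ⊗ I
  ⊗-cong I e = record
    { emb  = record
      { to     = ×.map₂ (fun e)
      ; mono   = ⊎.map₂ (×.map₂ (mono (emb e)))
      ; cancel = ⊎.map₂ (×.map₂ (cancel (emb e)))
      }
    ; onto = λ (i , y) → (i , inv e y) , DecTotalOrder.Eq.refl I , fun-inv e y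
    }

  ⊕-cong : A ≃ B → S ≃ T → A ⊕ S ≃ B ⊕ T
  ⊕-cong {A = A} {B = B} {S = S} {T = T} e f = record
    { emb  = record
      { to     = ⊎.map (fun e) (fun f)
      ; mono   = λ where
          ₁∼₂     → ₁∼₂
          (₁∼₁ p) → ₁∼₁ (mono (emb e) p)
          (₂∼₂ p) → ₂∼₂ (mono (emb f) p)
      ; cancel = λ {x} {y} → reflect x y
      }
    ; onto = λ where
        (inj₁ y) → inj₁ (inv e y) , Pointwise.inj₁ (fun-inv e y)
        (inj₂ y) → inj₂ (inv f y) , Pointwise.inj₂ (fun-inv f y)
    }
    where
    reflect : ∀ x y → ⊎.map (fun e) (fun f) x ≤[ B ⊕ T ] ⊎.map (fun e) (fun f) y →
              x ≤[ A ⊕ S ] y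
    reflect (inj₁ _) (inj₂ _) ₁∼₂     = ₁∼₂
    reflect (inj₁ _) (inj₁ _) (₁∼₁ p) = ₁∼₁ (cancel (emb e) p)
    reflect (inj₂ _) (inj₂ _) (₂∼₂ p) = ₂∼₂ (cancel (emb f) p)

  -- Locally finite strict weak orders

  -- A strict weak order on X.  The classes of incomparability _∼_ are linearly
  -- ordered by _⊏_.

  record WeakOrder {ℓ} (X : Set ℓ) : Set (Level.suc ℓ) where
    infix 4 _∼_ _⊏_
    field
      _∼_ _⊏_ : Rel X ℓ
      ∼-refl  : ∀ {x} → x ∼ x
      ∼-sym   : ∀ {x y} → x ∼ y → y ∼ x
      ∼-trans : ∀ {x y z} → x ∼ y → y ∼ z → x ∼ z
      irrefl  : ∀ {x y} → x ∼ y → ¬ x ⊏ y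
      ⊏-trans : ∀ {x y z} → x ⊏ y → y ⊏ z → x ⊏ z
      compare : ∀ x y → x ⊏ y ⊎ x ∼ y ⊎ y ⊏ x

    ∼-⊏ : ∀ {x y z} → x ∼ y → y ⊏ z → x ⊏ z
    ∼-⊏ {x} {y} {z} x∼y y⊏z with compare x z
    ... | inj₁ x⊏z        = x⊏z
    ... | inj₂ (inj₁ x∼z) = ⊥-elim (irrefl (∼-trans (∼-sym x∼y) x∼z) y⊏z)
    ... | inj₂ (inj₂ z⊏x) = ⊥-elim (irrefl (∼-sym x∼y) (⊏-trans y⊏z z⊏x))

    ⊏-∼ : ∀ {x y z} → x ⊏ y → y ∼ z → x ⊏ z
    ⊏-∼ {x} {y} {z} x⊏y y∼z with compare x z
    ... | inj₁ x⊏z        = x⊏z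
    ... | inj₂ (inj₁ x∼z) = ⊥-elim (irrefl (∼-trans x∼z (∼-sym y∼z)) x⊏y)
    ... | inj₂ (inj₂ z⊏x) = ⊥-elim (irrefl (∼-sym y∼z) (⊏-trans z⊏x x⊏y))

    -- P meets finitely many classes.

    Covered : (X → Set ℓ) → Set ℓ
    Covered P = Σ[ zs ∈ List X ] (∀ x → P x → Any (x ∼_) zs)

    -- Finitely many classes lie between any two points.

    LocallyFinite : Set ℓ
    LocallyFinite = ∀ x y → Covered (λ z → x ⊏ z × z ⊏ y)

    Minimal : (X → Set ℓ) → X → Set ℓ
    Minimal P m = P m × (∀ x → P x → ¬ x ⊏ m)

    -- By induction on the cover.  Let m be minimal among the points of P outside
    -- the class of the first member z.  If some point of P in the class of z is
    -- below m then that point is minimal in P, and otherwise m is.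

    minimal-exists : {P : X → Set ℓ} → Covered P → ∃ P → ∃ (Minimal P)
    minimal-exists {P} (zs , c) = go zs P c
      where
      go : (zs : List X) (P : X → Set ℓ) → (∀ x → P x → Any (x ∼_) zs) → ∃ P → ∃ (Minimal P)
      go []       P c (x , px) with c x px
      ... | ()
      go (z ∷ zs) P c (x , px) with em {P = ∃[ u ] (P u × ¬ u ∼ z)}
      ... | no none = x , px , λ u pu → irrefl (∼-trans (in-z u pu) (∼-sym (in-z x px)))
        where
        in-z : ∀ u → P u → u ∼ z
        in-z u pu = by-contradiction λ u≁z → none (u , pu , u≁z)
      ... | yes (u , pu , u≁z) with go zs (λ v → P v × ¬ v ∼ z)
                                     (λ v (pv , v≁z) → Any.tail v≁z (c v pv)) (u , pu , u≁z)
      ...   | m , (pm , _) , least with em {P = ∃[ v ] (P v × v ∼ z × v ⊏ m)}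
      ...     | no none = m , pm , λ v pv v⊏m →
                  least v (pv , λ v∼z → none (v , pv , v∼z , v⊏m)) v⊏m
      ...     | yes (v , pv , v∼z , v⊏m) = v , pv , λ w pw w⊏v →
                  least w (pw , λ w∼z → irrefl (∼-trans w∼z (∼-sym v∼z)) w⊏v) (⊏-trans w⊏v v⊏m)

    -- The class of y is the next above that of x.

    Next : X → X → Set ℓ
    Next x y = x ⊏ y × (∀ z → x ⊏ z → ¬ z ⊏ y)

    -- The next class is a minimal one among those above x and not above y.

    next-exists : LocallyFinite → ∀ {x y} → x ⊏ y → ∃ (Next x)
    next-exists lf {x} {y} x⊏y = proj₁ min , proj₁ (proj₁ (proj₂ min)) , λ z x⊏z z⊏m →
        proj₂ (proj₂ min) z (x⊏z , λ y⊏z → proj₂ (proj₁ (proj₂ min)) (⊏-trans y⊏z z⊏m)) z⊏m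
      where
      cover : ∀ z → x ⊏ z × ¬ y ⊏ z → Any (z ∼_) (y ∷ proj₁ (lf x y))
      cover z (x⊏z , y⊏̸z) with compare z y
      ... | inj₁ z⊏y        = there (proj₂ (lf x y) z (x⊏z , z⊏y))
      ... | inj₂ (inj₁ z∼y) = here z∼y
      ... | inj₂ (inj₂ y⊏z) = ⊥-elim (y⊏̸z y⊏z)
      min : ∃ (Minimal (λ z → x ⊏ z × ¬ y ⊏ z))
      min = minimal-exists (_ , cover) (y , x⊏y , irrefl ∼-refl)

  open WeakOrder

  dual : {X : Set ℓ} → WeakOrder X → WeakOrder X
  dual O = record
    { _∼_     = _∼_ O
    ; _⊏_     = λ x y → _⊏_ O y x
    ; ∼-refl  = ∼-refl O
    ; ∼-sym   = ∼-sym O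
    ; ∼-trans = ∼-trans O
    ; irrefl  = irrefl O ∘ ∼-sym O
    ; ⊏-trans = λ p q → ⊏-trans O q p
    ; compare = λ x y → ⊎.map₂ (⊎.map₁ (∼-sym O)) (compare O y x)
    }

  dual-finite : {X : Set ℓ} (O : WeakOrder X) → LocallyFinite O → LocallyFinite (dual O)
  dual-finite O lf x y = proj₁ (lf y x) , λ z (z⊏x , y⊏z) → proj₂ (lf y x) z (y⊏z , z⊏x)

  -- The class of x₀ and the classes that successively follow it, in an order with
  -- no last class.

  module Ascent {X : Set ℓ} (O : WeakOrder X) (lf : LocallyFinite O)
                (unbounded : ∀ x → ∃ (_⊏_ O x)) (x₀ : X) where
    private module O = WeakOrder O

    next : ∀ x → ∃ (Next O x)
    next x = next-exists O lf (proj₂ (unbounded x))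

    climb : ℕ → X
    climb zero    = x₀
    climb (suc n) = proj₁ (next (climb n))

    climb-step : ∀ n → climb n O.⊏ climb (suc n)
    climb-step n = proj₁ (proj₂ (next (climb n)))

    climb-mono : ∀ m n → m ℕ.< n → climb m O.⊏ climb n
    climb-mono m (suc n) (s≤s m≤n) with ℕ.m≤n⇒m<n∨m≡n m≤n
    ... | inj₁ m<n  = O.⊏-trans (climb-mono m n m<n) (climb-step n)
    ... | inj₂ refl = climb-step m

    -- If a class above that of x₀ is missed then so is a least one.  The class
    -- before it is reached, and hence the missed class is the next one climbed.

    reached : ∀ y → ¬ y O.⊏ x₀ → ∃[ n ] y O.∼ climb n
    reached y y⊏̸x₀ = by-contradiction λ unreached →
      impossible (minimal-exists O (_ , cover) (y , y⊏̸x₀ , irrefl O (∼-refl O) , unreached))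
      where
      Missed : X → Set ℓ
      Missed z = ¬ z O.⊏ x₀ × ¬ y O.⊏ z × ¬ (∃[ n ] z O.∼ climb n)
      cover : ∀ z → Missed z → Any (z O.∼_) (x₀ ∷ y ∷ proj₁ (lf x₀ y))
      cover z (z⊏̸x₀ , y⊏̸z , _) with O.compare z x₀ | O.compare z y
      ... | inj₁ z⊏x₀        | _                = ⊥-elim (z⊏̸x₀ z⊏x₀)
      ... | inj₂ (inj₁ z∼x₀) | _                = here z∼x₀
      ... | inj₂ (inj₂ _)    | inj₂ (inj₁ z∼y)  = there (here z∼y)
      ... | inj₂ (inj₂ _)    | inj₂ (inj₂ y⊏z)  = ⊥-elim (y⊏̸z y⊏z)
      ... | inj₂ (inj₂ x₀⊏z) | inj₁ z⊏y         = there (there (proj₂ (lf x₀ y) z (x₀⊏z , z⊏y)))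
      impossible : ¬ ∃ (Minimal O Missed)
      impossible (m , (m⊏̸x₀ , y⊏̸m , m-missed) , least) with O.compare m x₀
      ... | inj₁ m⊏x₀        = m⊏̸x₀ m⊏x₀
      ... | inj₂ (inj₁ m∼x₀) = m-missed (0 , m∼x₀)
      ... | inj₂ (inj₂ x₀⊏m) with next-exists (dual O) (dual-finite O lf) x₀⊏m
      ...   | w , w⊏m , no-gap = least w (w⊏̸x₀ , y⊏̸w , w-missed) w⊏m
        where
        w⊏̸x₀ : ¬ w O.⊏ x₀
        w⊏̸x₀ w⊏x₀ = no-gap x₀ x₀⊏m w⊏x₀
        y⊏̸w : ¬ y O.⊏ w
        y⊏̸w y⊏w = y⊏̸m (O.⊏-trans y⊏w w⊏m)
        w-missed : ¬ (∃[ n ] w O.∼ climb n)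
        w-missed (n , w∼n) with O.compare m (climb (suc n))
        ... | inj₁ m⊏n+1        = proj₂ (proj₂ (next (climb n))) m (O.∼-⊏ (O.∼-sym w∼n) w⊏m) m⊏n+1
        ... | inj₂ (inj₁ m∼n+1) = m-missed (suc n , m∼n+1)
        ... | inj₂ (inj₂ n+1⊏m) = no-gap (climb (suc n)) n+1⊏m (O.∼-⊏ w∼n (climb-step n))

  -- Gradings by classes

  -- The order of the classes of ρ A α.

  classes : (A : Chain ℓ) → Ord ℓ → WeakOrder ∣ A ∣
  classes A α = record
    { _∼_     = ρ A α
    ; _⊏_     = λ x y → x ≤[ A ] y × ¬ ρ A α x y
    ; ∼-refl  = ρ-refl A α
    ; ∼-sym   = ρ-sym A α
    ; ∼-trans = ρ-trans A α
    ; irrefl  = λ p (_ , ¬p) → ¬p p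
    ; ⊏-trans = λ (x≤y , ¬p) (y≤z , _) →
        C.trans A x≤y y≤z , λ q → ¬p (ρ-convex A α (inj₁ (x≤y , y≤z)) q)
    ; compare = cmp
    }
    where
    cmp : ∀ x y → (x ≤[ A ] y × ¬ ρ A α x y) ⊎ ρ A α x y ⊎ (y ≤[ A ] x × ¬ ρ A α y x)
    cmp x y with em {P = ρ A α x y} | C.total A x y
    ... | yes p | _        = inj₂ (inj₁ p)
    ... | no ¬p | inj₁ x≤y = inj₁ (x≤y , ¬p)
    ... | no ¬p | inj₂ y≤x = inj₂ (inj₂ (y≤x , ¬p ∘ ρ-sym A α))

  -- A grading whose nonempty fibres are the classes of ρ A α, and with no
  -- empty fibre above a nonempty one.

  record Classes {ℓ} (A : Chain ℓ) (α : Ord ℓ) : Set ℓ where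
    field
      grading : Grading A
      same    : ∀ {x y} → π grading x ≡ π grading y → ρ A α x y
      apart   : ∀ {x y} → ρ A α x y → π grading x ≡ π grading y
      higher  : ∀ x m → ∣ Fib grading (π grading x ℤ.+ +[1+ m ]) ∣

  -- If any two points of a fibre are related by ρ A α, then the interval from x
  -- up to y is covered by the classes of x and of one point from each of the
  -- fibres π x + 1, ..., π y.

  fibres-collapse : (g : Grading A) → (∀ x m → ∣ Fib g (π g x ℤ.+ +[1+ m ]) ∣) →
                    (∀ {x y} → π g x ≡ π g y → ρ A α x y) → Collapsed A (suc α)
  fibres-collapse {A = A} {α = α} g higher same = collapse related′
    where
    upwards : ∀ {x y} → x ≤[ A ] y → ρ A (suc α) x y
    upwards {x} {y} x≤y = finitelyMany⇒ρ A α (x ∷ applyUpTo rep d , cover)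
      where
      rep : ℕ → ∣ A ∣
      rep m = proj₁ (higher x m)
      d : ℕ
      d = proj₁ (distance g x≤y)
      covered : ∀ {z} → x ≤[ A ] z → z ≤[ A ] y → Any (ρ A α z) (x ∷ applyUpTo rep d)
      covered x≤z z≤y with distance g x≤z
      ... | zero  , p = here (same (trans p (ℤ.+-identityʳ _)))
      ... | suc m , p = there (Any.applyUpTo⁺ rep (same (trans p (sym (proj₂ (higher x m)))))
                          (i+m≤i+n⇒m≤n (π g x)
                            (subst₂ ℤ._≤_ p (proj₂ (distance g x≤y)) (π-mono g z≤y))))
      cover : ∀ z → Between A x y z → Any (ρ A α z) (x ∷ applyUpTo rep d)
      cover z (inj₁ (x≤z , z≤y)) = covered x≤z z≤y
      cover z (inj₂ (y≤z , z≤x)) = covered (C.trans A x≤y y≤z) (C.trans A z≤x x≤y)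
    related′ : ∀ x y → ρ A (suc α) x y
    related′ x y with C.total A x y
    ... | inj₁ x≤y = upwards x≤y
    ... | inj₂ y≤x = ρ-sym A (suc α) (upwards y≤x)

  Classes-Rank : Classes A α → ∣ A ∣ → Rank A (suc α)
  Classes-Rank {A = A} {α = α} K x = Rank-suc x
    (fibres-collapse grading higher same)
    -- The first fibre above that of x is another class.
    (λ c → let (y , πy) = higher x 0 in
      ℤ.<⇒≢ (i<i+1+m (π grading x) 0) (trans (apart (related c x y)) πy))
    where open Classes K

  -- The rank of a layered chain

  module _ {A D : Chain ℓ} (L : Layered A D) (d : ∣ D ∣) where
    private g = layers L

    -- If points of distinct fibres are related by ρ A (suc γ), then the part of
    -- the lower fibre above x meets finitely many classes of ρ A γ.  The last of
    -- them contains a tail of the fibre, which collapses D.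

    merge : ∀ γ {x y} → π g x ℤ.< π g y → ρ A (suc γ) x y → Collapsed D γ
    merge γ {x} {y} πx<πy p = spread (fib-tails L (π g x)) (m , πm) (collapse rel)
      where
      zs = ρ⇒finitelyMany A γ p
      Upper : ∣ A ∣ → Set ℓ
      Upper w = x ≤[ A ] w × π g w ≡ π g x
      top : ∃ (Minimal (dual (classes A γ)) Upper)
      top = minimal-exists (dual (classes A γ))
              (proj₁ zs , λ w (x≤w , πw) → proj₂ zs w
                (inj₁ (x≤w , π<⇒≤ g (subst (ℤ._< π g y) (sym πw) πx<πy))))
              (x , C.refl A , refl)
      m : ∣ A ∣
      m = proj₁ top
      πm : π g m ≡ π g x
      πm = proj₂ (proj₁ (proj₂ top))
      to-m : ∀ w → m ≤[ A ] w → π g w ≡ π g x → ρ A γ m w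
      to-m w m≤w πw = by-contradiction λ ¬p →
        proj₂ (proj₂ top) w (C.trans A (proj₁ (proj₁ (proj₂ top))) m≤w , πw) (m≤w , ¬p)
      F : Chain ℓ
      F = Fib g (π g x)
      rel : ∀ u v → ρ (F ^≥ (m , πm)) γ u v
      rel u@((u′ , pu) , m≤u) v@((v′ , pv) , m≤v) =
        ρ-pull (tail↪ F (m , πm)) (tail-convex F (m , πm)) γ {u} {v}
          (ρ-pull (fib↪ g (π g x)) (fib-convex g (π g x)) γ {u′ , pu} {v′ , pv}
            (ρ-trans A γ (ρ-sym A γ (to-m u′ m≤u pu)) (to-m v′ m≤v pv)))

    no-merge : ∀ β → (∀ γ → γ <ₒ β → ¬ Collapsed D γ) →
               ∀ {x y} → ρ A β x y → π g x ≡ π g y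
    no-merge zero       _   p       = π-cong g p
    no-merge (lim i₀ f) ¬c  (i , p) = no-merge (f i) (λ γ γ<fi → ¬c γ (≤lim i γ<fi)) p
    no-merge (suc γ)    ¬c  {x} {y} p with ℤ.<-cmp (π g x) (π g y)
    ... | tri< πx<πy _ _ = ⊥-elim (¬c γ ≤ₒ-refl (merge γ πx<πy p))
    ... | tri≈ _ πx≡πy _ = πx≡πy
    ... | tri> _ _ πy<πx = ⊥-elim (¬c γ ≤ₒ-refl (merge γ πy<πx (ρ-sym A (suc γ) p)))

    layered-same : Collapsed D α → ∀ {x y} → π g x ≡ π g y → ρ A α x y
    layered-same {α = α} c {x} {y} p =
      ρ-push (fib↪ g (π g y)) (fib-convex g (π g y)) α {x , p} {y , refl}
        (related (Collapsed-Tails (Tails-sym (fib-tails L (π g y))) d c) (x , p) (y , refl))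

    layered-classes : Rank D α → Classes A α
    layered-classes {α = α} r = record
      { grading = g
      ; same    = layered-same (collapsed r)
      ; apart   = no-merge α (minimal r)
      ; higher  = λ x m → inv (fib-above L x m) d
      }

    layered-collapse : Collapsed D β → Collapsed A (suc β)
    layered-collapse c =
      fibres-collapse g (λ x m → inv (fib-above L x m) d) (layered-same c)

  -- The classes of a uniform chain

  -- The classes are numbered by all integers, or by the natural numbers.

  data Shape {ℓ} (A : Chain ℓ) (α : Ord ℓ) : Set ℓ where
    two-sided : (K : Classes A α) → let open Classes K in
                (∀ i → ∣ Fib grading i ∣) → Shape A α
    one-sided : (K : Classes A α) → let open Classes K in
                ∣ Fib grading 0ℤ ∣ → (∀ m → ¬ ∣ Fib grading -[1+ m ] ∣) → Shape A α

  -- A numbering of the classes of ρ A α by integers, given as a relation: E i x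
  -- says that the i-th class contains x.  Some E i may be empty, but not above a
  -- nonempty one.

  module Numbered {A : Chain ℓ} {α : Ord ℓ} (E : ℤ → ∣ A ∣ → Set ℓ)
                  (number   : ∀ x → ∃[ i ] E i x)
                  (E-same   : ∀ {i x y} → E i x → E i y → ρ A α x y)
                  (E-mono   : ∀ {i j x y} → i ℤ.< j → E i x → E j y → _⊏_ (classes A α) x y)
                  (E-higher : ∀ i {x} m → E i x → ∃[ y ] E (i ℤ.+ +[1+ m ]) y) where

    private module O = WeakOrder (classes A α)

    num : ∣ A ∣ → ℤ
    num x = proj₁ (number x)

    E-unique : ∀ {i j x y} → ρ A α x y → E i x → E j y → i ≡ j
    E-unique {i} {j} p e e′ with ℤ.<-cmp i j
    ... | tri< i<j _ _ = ⊥-elim (O.irrefl p (E-mono i<j e e′))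
    ... | tri≈ _ i≡j _ = i≡j
    ... | tri> _ _ j<i = ⊥-elim (O.irrefl (O.∼-sym p) (E-mono j<i e′ e))

    E-num : ∀ {i x} → E i x → num x ≡ i
    E-num e = E-unique O.∼-refl (proj₂ (number _)) e

    num-mono : ∀ {x y} → x ≤[ A ] y → num x ℤ.≤ num y
    num-mono {x} {y} x≤y with num x ℤ.≤? num y
    ... | yes p = p
    ... | no ¬p with E-mono (ℤ.≰⇒> ¬p) (proj₂ (number y)) (proj₂ (number x))
    ...   | y≤x , y≁x = ⊥-elim (y≁x (ρ-reflexive A α (C.antisym A y≤x x≤y)))

    numbered-classes : Classes A α
    numbered-classes = record
      { grading = record { π = num ; π-mono = num-mono }
      ; same    = λ {x} {y} p →
          E-same (subst (λ i → E i x) p (proj₂ (number x))) (proj₂ (number y))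
      ; apart   = λ p → E-unique p (proj₂ (number _)) (proj₂ (number _))
      ; higher  = λ x m → let (y , e) = E-higher (num x) m (proj₂ (number x)) in y , E-num e
      }

  module _ {A : Chain ℓ} {α : Ord ℓ} (u : Tails A A) (r : Rank A (suc α)) where
    private
      O = classes A α
      module O = WeakOrder O

    classes-finite : LocallyFinite O
    classes-finite x y with ρ⇒finitelyMany A α (related (collapsed r) x y)
    ... | zs , c = zs , λ z ((x≤z , _) , (z≤y , _)) → c z (inj₁ (x≤z , z≤y))

    -- If x belonged to a last class then the tail at x would be collapsed, and by
    -- uniformity A would be collapsed at α.

    no-last-class : ∀ x → ∃ (x O.⊏_)
    no-last-class x = by-contradiction λ none →
      minimal r α ≤ₒ-refl (spread u x (collapse λ (v , x≤v) (w , x≤w) →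
        ρ-pull (tail↪ A x) (tail-convex A x) α
          (O.∼-trans (O.∼-sym (below none x≤v)) (below none x≤w))))
      where
      below : ¬ ∃ (x O.⊏_) → ∀ {v} → x ≤[ A ] v → x O.∼ v
      below none {v} x≤v = by-contradiction λ x≁v → none (v , x≤v , x≁v)

    module Up = Ascent O classes-finite no-last-class

    one-sided-shape : ∀ x₀ → ¬ ∃ (O._⊏ x₀) → Shape A α
    one-sided-shape x₀ first = one-sided numbered-classes (x₀ , E-num {+ zero} O.∼-refl)
        λ { m (x , ()) }
      where
      open Up x₀
      E : ℤ → ∣ A ∣ → Set ℓ
      E (+ n)    x = x O.∼ climb n
      E -[1+ _ ] x = Level.Lift ℓ ⊥
      n : ∀ x → ∃[ n ] x O.∼ climb n
      n x = reached x (λ x⊏x₀ → first (x , x⊏x₀))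
      E-mono : ∀ {i j x y} → i ℤ.< j → E i x → E j y → x O.⊏ y
      E-mono {+ i} {+ j} (ℤ.+<+ i<j) e e′ = O.⊏-∼ (O.∼-⊏ e (climb-mono i j i<j)) (O.∼-sym e′)
      E-mono ℤ.-<+       (lift ())
      E-mono (ℤ.-<- _)   (lift ())
      E-same : ∀ {i x y} → E i x → E i y → x O.∼ y
      E-same {+ n}    e e′ = O.∼-trans e (O.∼-sym e′)
      E-same { -[1+ _ ]} (lift ())
      E-higher : ∀ i {x} m → E i x → ∃[ y ] E (i ℤ.+ +[1+ m ]) y
      E-higher (+ n)    m e = climb (n ℕ.+ suc m) , O.∼-refl
      E-higher -[1+ _ ] m (lift ())
      open Numbered {A = A} {α = α} E (λ x → + proj₁ (n x) , proj₂ (n x))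
                    (λ {i} → E-same {i}) E-mono E-higher

    two-sided-shape : (∀ x → ∃ (O._⊏ x)) → Shape A α
    two-sided-shape no-first = two-sided numbered-classes λ i → r′ i , E-num O.∼-refl
      where
      x₀ : ∣ A ∣
      x₀ = point r
      open Up x₀
      module Down = Ascent (dual O) (dual-finite O classes-finite) no-first x₀
      r′ : ℤ → ∣ A ∣
      r′ (+ n)    = climb n
      r′ -[1+ n ] = Down.climb (suc n)
      r-mono : ∀ {i j} → i ℤ.< j → r′ i O.⊏ r′ j
      r-mono {+ i} {+ j} (ℤ.+<+ i<j) = climb-mono i j i<j
      r-mono { -[1+ i ]} { -[1+ j ]} (ℤ.-<- j<i) = Down.climb-mono (suc j) (suc i) (s≤s j<i)
      r-mono { -[1+ m ]} {+ zero}   ℤ.-<+ = Down.climb-mono 0 (suc m) (s≤s z≤n)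
      r-mono { -[1+ m ]} { +[1+ n ]} ℤ.-<+ =
        O.⊏-trans (Down.climb-mono 0 (suc m) (s≤s z≤n)) (climb-mono 0 (suc n) (s≤s z≤n))
      from-below : ∀ x → ∃[ n ] x O.∼ Down.climb n → ∃[ i ] x O.∼ r′ i
      from-below x (zero  , p) = + zero , p
      from-below x (suc n , p) = -[1+ n ] , p
      number : ∀ x → ∃[ i ] x O.∼ r′ i
      number x with O.compare x x₀
      ... | inj₁ x⊏x₀ =
        from-below x (Down.reached x λ x₀⊏x → O.irrefl O.∼-refl (O.⊏-trans x⊏x₀ x₀⊏x))
      ... | inj₂ (inj₁ x∼x₀) = + zero , x∼x₀
      ... | inj₂ (inj₂ x₀⊏x) =
        ×.map +_ id (reached x λ x⊏x₀ → O.irrefl O.∼-refl (O.⊏-trans x⊏x₀ x₀⊏x))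
      open Numbered {A = A} {α = α} (λ i x → x O.∼ r′ i) number
                    (λ e e′ → O.∼-trans e (O.∼-sym e′))
                    (λ i<j e e′ → O.⊏-∼ (O.∼-⊏ e (r-mono i<j)) (O.∼-sym e′))
                    (λ i m _ → r′ (i ℤ.+ +[1+ m ]) , O.∼-refl)

    shape : Shape A α
    shape with em {P = ∃[ x ] ¬ ∃ (O._⊏ x)}
    ... | yes (x₀ , first) = one-sided-shape x₀ first
    ... | no ¬first = two-sided-shape λ x → by-contradiction λ none → ¬first (x , none)

  -- Comparison of chains with the same tails

  at-distance : (K : Classes A α) → let g = Classes.grading K in
                ∀ x m → Σ[ v ∈ ∣ A ∣ ] x ≤[ A ] v × π g v ≡ π g x ℤ.+ + m
  at-distance {A = A} K x zero    = x , C.refl A , sym (ℤ.+-identityʳ _)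
  at-distance {A = A} K x (suc m) = proj₁ v ,
    π<⇒≤ grading (subst (π grading x ℤ.<_) (sym (proj₂ v)) (i<i+1+m (π grading x) m)) , proj₂ v
    where open Classes K
          v = higher x m

  -- An isomorphism of tails preserves ρ_α.  If u lies m classes above x then the
  -- classes in between are mapped to distinct ones, so its image lies at least m
  -- classes above y; the inverse gives the converse bound.

  module _ {A B : Chain ℓ} {α : Ord ℓ} (K : Classes A α) (K′ : Classes B α)
           {x : ∣ A ∣} {y : ∣ B ∣} where
    private
      g = Classes.grading K
      h = Classes.grading K′

    rises : (e : A ^≥ x ≃ B ^≥ y) → ∀ m u → π g (proj₁ u) ≡ π g x ℤ.+ + m →
            π h y ℤ.+ + m ℤ.≤ π h (proj₁ (fun e u))
    rises e zero    u p = subst (ℤ._≤ π h (proj₁ (fun e u))) (sym (ℤ.+-identityʳ _))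
                            (π-mono h (proj₂ (fun e u)))
    rises e (suc m) u p =
      subst (ℤ._≤ π h (proj₁ (fun e u))) (1+[i+m] (π h y) m)
        (ℤ.i<j⇒suc[i]≤j (ℤ.≤-<-trans (rises e m v πv) (ℤ.≤∧≢⇒< (π-mono h fv≤fu) fv≢fu)))
      where
      v : ∣ A ^≥ x ∣
      v = let (w , x≤w , _) = at-distance K x m in w , x≤w
      πv : π g (proj₁ v) ≡ π g x ℤ.+ + m
      πv = proj₂ (proj₂ (at-distance K x m))
      πv<πu : π g (proj₁ v) ℤ.< π g (proj₁ u)
      πv<πu = subst (ℤ._< π g (proj₁ u)) (sym πv)
                (subst (π g x ℤ.+ + m ℤ.<_) (sym p) (ℤ.+-monoʳ-< (π g x) (ℤ.+<+ ℕ.≤-refl)))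
      fv≤fu : proj₁ (fun e v) ≤[ B ] proj₁ (fun e u)
      fv≤fu = mono (emb e) {v} {u} (π<⇒≤ g πv<πu)
      fv≢fu : π h (proj₁ (fun e v)) ≢ π h (proj₁ (fun e u))
      fv≢fu q = ℤ.<⇒≢ πv<πu (Classes.apart K
        (ρ-push (tail↪ A x) (tail-convex A x) α {v} {u}
          (ρ-pull (emb e) (≃-convex e) α
            (ρ-pull (tail↪ B y) (tail-convex B y) α (Classes.same K′ q)))))

  module _ {A B : Chain ℓ} {α : Ord ℓ} (K : Classes A α) (K′ : Classes B α)
           {x : ∣ A ∣} {y : ∣ B ∣} (e : A ^≥ x ≃ B ^≥ y) where
    private
      g = Classes.grading K
      h = Classes.grading K′

    level : ∀ m u → π g (proj₁ u) ≡ π g x ℤ.+ + m → π h (proj₁ (fun e u)) ≡ π h y ℤ.+ + m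
    level m u p = trans q (cong (λ k → π h y ℤ.+ + k) (ℕ.≤-antisym m′≤m m≤m′))
      where
      d = distance h (proj₂ (fun e u))
      m′ : ℕ
      m′ = proj₁ d
      q : π h (proj₁ (fun e u)) ≡ π h y ℤ.+ + m′
      q = proj₂ d
      m≤m′ : m ℕ.≤ m′
      m≤m′ = i+m≤i+n⇒m≤n (π h y) (subst (π h y ℤ.+ + m ℤ.≤_) q (rises K K′ e m u p))
      m′≤m : m′ ℕ.≤ m
      m′≤m = i+m≤i+n⇒m≤n (π g x) (subst (π g x ℤ.+ + m′ ℤ.≤_)
               (trans (π-cong g (inv-fun e u)) p) (rises K′ K (≃-sym e) m′ (fun e u) q))

  module _ {A B : Chain ℓ} {α : Ord ℓ} (K : Classes A α) (K′ : Classes B α) (t : Tails A B) where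
    private
      g = Classes.grading K
      h = Classes.grading K′

    level-≃ : ∀ x y m → Fib (tail-grading g x) (+ m) ≃ Fib (tail-grading h y) (+ m)
    level-≃ x y m = same-image {A = B ^≥ y}
        (emb e ∘↪ fib↪ (tail-grading g x) (+ m)) (fib↪ (tail-grading h y) (+ m))
        (λ (u , p) → (fun e u , offset (π h (proj₁ (fun e u))) (π h y)
                                  (level K K′ e m u (offset⁻¹ (π g (proj₁ u)) (π g x) p)))
                     , C.Eq.refl B)
        (λ (v , p) → (inv e v , offset (π g (proj₁ (inv e v))) (π g x)
                                  (level K′ K (≃-sym e) m v (offset⁻¹ (π h (proj₁ v)) (π h y) p)))
                     , fun-inv e v)
      where e = tail t x y

    classes-tails : ∀ i j → Tails (Fib g i) (Fib h j)
    classes-tails i j = tails λ { (x , refl) (y , refl) →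
      ≃-trans (≃-sym (first-fib g x)) (≃-trans (level-≃ x y 0) (first-fib h y)) }

    classes-above : ∀ x y m → Fib g (π g x ℤ.+ +[1+ m ]) ≃ Fib h (π h y ℤ.+ +[1+ m ])
    classes-above x y m =
      ≃-trans (≃-sym (later-fib g x m)) (≃-trans (level-≃ x y (suc m)) (later-fib h y m))

  -- If A has the tails of a chain layered over D then the classes of A are layers
  -- over D.

  transfer : (K : Classes A α) (L : Layered B D) (d : ∣ D ∣) (r : Rank D α) (y : ∣ B ∣) →
             Tails A B → Layered A D
  transfer K L d r y t = record
    { layers    = Classes.grading K
    ; fib-tails = λ i → Tails-trans (y , refl) (classes-tails K K′ t i (π (layers L) y))
                          (fib-tails L (π (layers L) y))
    ; fib-above = λ x m → ≃-trans (classes-above K K′ t x y m) (fib-above L y m)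
    }
    where K′ = layered-classes L d r

  -- The class next above that of x.

  class-above : (K : Classes A α) → ∣ A ∣ → Chain _
  class-above K x = Fib g (π g x ℤ.+ +[1+ 0 ])
    where g = Classes.grading K

  self-layered : (K : Classes A α) (x : ∣ A ∣) → Tails A A → Layered A (class-above K x)
  self-layered K x t = record
    { layers    = g
    ; fib-tails = λ i → classes-tails K K t i (π g x ℤ.+ +[1+ 0 ])
    ; fib-above = λ y m → ≃-trans (at y m) (classes-above K K t (w y m) x 0)
    }
    where
    g = Classes.grading K
    w : ∀ y m → _
    w y m = proj₁ (at-distance K y m)
    at : ∀ y m → Fib g (π g y ℤ.+ +[1+ m ]) ≃ Fib g (π g (w y m) ℤ.+ +[1+ 0 ])
    at y m = ≡⇒≃ (cong (Fib g) (trans (sym (1+[i+m] (π g y) m))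
      (trans (ℤ.+-comm ℤ.1ℤ (π g y ℤ.+ + m))
             (cong (ℤ._+ ℤ.1ℤ) (sym (proj₂ (proj₂ (at-distance K y m))))))))

  class-above-rank : (K : Classes A α) (x : ∣ A ∣) → Tails A A → Rank A (suc α) →
                     Rank (class-above K x) α
  class-above-rank {α = α} K x t r = record
    { point     = higher x 0
    ; collapsed = collapse λ (u , p) (v , q) →
        ρ-pull (fib↪ grading _) (fib-convex grading _) α (same (trans p (sym q)))
    ; minimal   = λ β β<α c → minimal r (suc β) (suc≤suc β<α)
        (layered-collapse (self-layered K x t) (higher x 0) c)
    }
    where open Classes K

  two-sided-≃ : (L : Layered A D) → (∀ i → ∣ Fib (layers L) i ∣) → A ≃ D ⊗ ℤᶜ
  two-sided-≃ L inhabited = glue (layers L) ⊗ℤ-grading λ i →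
    ≃-trans (copy-at i) (≃-sym (⊗ℤ-fib i))
    where
    g = layers L
    copy-at : ∀ i → Fib g i ≃ _
    copy-at i with inhabited (i ℤ.- ℤ.1ℤ)
    ... | x , p = subst (λ j → Fib g j ≃ _)
                    (trans (cong (ℤ._+ ℤ.1ℤ) p)
                           (trans (ℤ.+-assoc i (ℤ.- ℤ.1ℤ) ℤ.1ℤ) (ℤ.+-identityʳ i)))
                    (fib-above L x 0)

  one-sided-≃ : (L : Layered A D) → ∣ Fib (layers L) 0ℤ ∣ →
                (∀ m → ¬ ∣ Fib (layers L) -[1+ m ] ∣) → A ≃ Fib (layers L) 0ℤ ⊕ D ⊗ ℕᶜ
  one-sided-≃ {D = D} L (x , p) none = glue (layers L) ⊕ℕ-grading λ where
      (+ zero)  → ≃-sym (⊕ℕ-fib-zero {B = D})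
      +[1+ m ]  → ≃-trans (above m) (≃-sym (⊕ℕ-fib-suc {A = F} m))
      -[1+ m ]  → empty-≃ (none m) (⊕ℕ-no-fib {A = F} {B = D} m)
    where
    F = Fib (layers L) 0ℤ
    above : ∀ m → Fib (layers L) +[1+ m ] ≃ D
    above m = subst (λ i → Fib (layers L) (i ℤ.+ +[1+ m ]) ≃ D) p (fib-above L x m)

  -- The chains 𝒜(s) as chains of the tree

  -- The chain of the subtree hanging from the node (s;k), with U j at each leaf
  -- labelled j.  Unlike in 𝒜, the family is the same for all subtrees.

  𝒯 : ∀ {n} → 𝒮 (suc n) → ℕ → (ℕ → Chain ℓ) → Chain ℓ
  𝒯 {n = zero}  s k U = U k
  𝒯 {n = suc n} (t ▷ b ▷ a) k U with view a
  ... | ‵fromℕ      = 𝒯 (t ▷ b) 0 U ⊗ ℤᶜ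
  ... | ‵inject₁ a′ = 𝒯 (t ▷ a′) (suc k) U ⊕ 𝒯 (t ▷ b) 0 U ⊗ ℕᶜ

  𝒯-top : ∀ {n} (t : 𝒮 n) c k (U : ℕ → Chain ℓ) →
          𝒯 (t ▷ c ▷ fromℕ (suc n)) k U ≡ 𝒯 (t ▷ c) 0 U ⊗ ℤᶜ
  𝒯-top {n = n} t c k U rewrite view-fromℕ (suc n) = refl

  𝒯-inject₁ : ∀ {n} (t : 𝒮 n) c a k (U : ℕ → Chain ℓ) →
              𝒯 (t ▷ c ▷ inject₁ a) k U ≡ 𝒯 (t ▷ a) (suc k) U ⊕ 𝒯 (t ▷ c) 0 U ⊗ ℕᶜ
  𝒯-inject₁ t c a k U rewrite view-inject₁ a = refl

  𝒜-𝒯 : ∀ {n} (s : 𝒮 (suc n)) k (M : Fin (#leaves s) → Chain ℓ) U →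
        (∀ i → M i ≡ U (leafLabel (tree s k) i)) → 𝒜 s M ≃ 𝒯 s k U
  𝒜-𝒯 {n = zero}  s k M U eq = ≡⇒≃ (eq Fin.zero)
  𝒜-𝒯 {n = suc n} (t ▷ b ▷ a) k M U eq with view a
  ... | ‵fromℕ      = ⊗-cong ℤᶜ (𝒜-𝒯 (t ▷ b) 0 M U eq)
  ... | ‵inject₁ a′ = ⊕-cong
    (𝒜-𝒯 (t ▷ a′) (suc k) _ U λ i →
      trans (eq _) (cong U (Vector.lookup-++ˡ (leafLabel (tree (t ▷ a′) (suc k))) _ i)))
    (⊗-cong ℕᶜ (𝒜-𝒯 (t ▷ b) 0 _ U λ i →
      trans (eq _) (cong U (Vector.lookup-++ʳ (leafLabel (tree (t ▷ a′) (suc k))) _ i))))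

  bound : ∀ n k {j} → j ℕ.≤ n ℕ.+ 0 → j ℕ.≤ suc n ℕ.+ k
  bound n k p = ℕ.≤-trans p (ℕ.≤-trans (ℕ.+-monoʳ-≤ n z≤n) (ℕ.n≤1+n _))

  -- The labels in the subtree of (s;k) are at most n + k, where |s| = n + 1.

  𝒯-cong : ∀ {n} (s : 𝒮 (suc n)) k (U V : ℕ → Chain ℓ) →
           (∀ j → j ℕ.≤ n ℕ.+ k → U j ≡ V j) → 𝒯 s k U ≃ 𝒯 s k V
  𝒯-cong {n = zero}  s k U V eq = ≡⇒≃ (eq k ℕ.≤-refl)
  𝒯-cong {n = suc n} (t ▷ b ▷ a) k U V eq with view a
  ... | ‵fromℕ      = ⊗-cong ℤᶜ (𝒯-cong (t ▷ b) 0 U V λ j p → eq j (bound n k p))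
  ... | ‵inject₁ a′ = ⊕-cong
    (𝒯-cong (t ▷ a′) (suc k) U V λ j p → eq j (ℕ.≤-trans p (ℕ.≤-reflexive (ℕ.+-suc n k))))
    (⊗-cong ℕᶜ (𝒯-cong (t ▷ b) 0 U V λ j p → eq j (bound n k p)))

  -- Uniformity and rank of 𝒜(s)

  -- All chains of the family, not only those at the leaves of a given tree, are
  -- uniform of rank ω with a common tail.  Uniformity is the case k = l.

  record Coherent {ℓ} (U : ℕ → Chain ℓ) : Set (Level.suc ℓ) where
    field
      common-tail : ∀ k l → Tails (U k) (U l)
      rank-ω      : ∀ k → Rank (U k) ω

  open Coherent

  module _ {U : ℕ → Chain ℓ} (coh : Coherent U) where

    𝒯-point : ∀ {n} (t : 𝒮 n) c a k → ∣ 𝒯 (t ▷ c) 0 U ∣ → ∣ 𝒯 (t ▷ c ▷ a) k U ∣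
    𝒯-point t c a k x with view a
    ... | ‵fromℕ     = 0ℤ , x
    ... | ‵inject₁ _ = inj₂ (0 , x)

    -- Layers over 𝒯 (t ▷ c) determine the tails at t ▷ c, and the tails at t make
    -- the chains at t ▷ c layered.

    𝒯-layered : ∀ {n} (t : 𝒮 n) c a k → Layered (𝒯 (t ▷ c ▷ a) k U) (𝒯 (t ▷ c) 0 U)
    𝒯-tails   : ∀ {n} (t : 𝒮 n) a b k l → Tails (𝒯 (t ▷ a) k U) (𝒯 (t ▷ b) l U)
    𝒯-rank    : ∀ {n} (t : 𝒮 n) a k → Rank (𝒯 (t ▷ a) k U) (ω +ₒ finₒ n)

    𝒯-layered t c a k with view a
    ... | ‵fromℕ      = ⊗ℤ-layered (𝒯-tails t c c 0 0)
    ... | ‵inject₁ a′ = ⊕ℕ-layered (𝒯-tails t a′ c (suc k) 0) (𝒯-tails t c c 0 0)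

    𝒯-tails ⟨⟩      a b k l = common-tail coh k l
    𝒯-tails (t ▷ c) a b k l =
      Layered-Tails (point (𝒯-rank t c 0)) (𝒯-layered t c a k) (𝒯-layered t c b l)

    𝒯-rank ⟨⟩      a k = rank-ω coh k
    𝒯-rank (t ▷ c) a k = Classes-Rank
      (layered-classes (𝒯-layered t c a k) (point (𝒯-rank t c 0)) (𝒯-rank t c 0))
      (𝒯-point t c a k (point (𝒯-rank t c 0)))

  -- Realization of uniform chains

  -- The family U with its k-th chain replaced by A.

  replace : ℕ → Chain ℓ → (ℕ → Chain ℓ) → ℕ → Chain ℓ
  replace k A U j with j ℕ.≟ k
  ... | yes _ = A
  ... | no _  = U j

  replace-hit : ∀ k (A : Chain ℓ) U → replace k A U k ≡ A
  replace-hit k A U with k ℕ.≟ k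
  ... | yes _  = refl
  ... | no k≢k = ⊥-elim (k≢k refl)

  replace-miss : ∀ {j k} (A : Chain ℓ) U → j ℕ.< k → replace k A U j ≡ U j
  replace-miss {j = j} {k} A U j<k with j ℕ.≟ k
  ... | yes j≡k = ⊥-elim (ℕ.<⇒≢ j<k j≡k)
  ... | no _    = refl

  replace-all : ∀ {p} (P : Chain ℓ → Set p) k {A U} →
                P A → (∀ j → P (U j)) → ∀ j → P (replace k A U j)
  replace-all P k pA pU j with j ℕ.≟ k
  ... | yes _ = pA
  ... | no _  = pU j

  replace-coherent : ∀ k {A : Chain ℓ} {U} → Coherent U → Tails A (U 0) → Rank A ω →
                     Coherent (replace k A U)
  replace-coherent k {A} {U} coh t r = record
    { common-tail = λ i j → replace-all (λ X → Tails X (replace k A U j)) k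
        (replace-all (Tails A) k (Tails-trans u₀ t (Tails-sym t)) from-A j)
        (λ l → replace-all (Tails (U l)) k (Tails-sym (from-A l)) (common-tail coh l) j)
        i
    ; rank-ω = replace-all (λ X → Rank X ω) k r (rank-ω coh)
    }
    where
    u₀ = point (rank-ω coh 0)
    from-A : ∀ l → Tails A (U l)
    from-A l = Tails-trans u₀ t (common-tail coh 0 l)

  -- A chain with the rank and the tails of the chains hanging from the nodes
  -- (t,a;k) is itself such a chain, if the family may be changed at labels from
  -- n + k on, where |t| = n.  By 𝒯-tails the tails do not depend on a and k, so
  -- they are given by the last entry n and k = 0.

  realize : ∀ {n} (t : 𝒮 n) {U : ℕ → Chain ℓ} → Coherent U → ∀ {B} k →
            Rank B (ω +ₒ finₒ n) → Tails B (𝒯 (t ▷ fromℕ n) 0 U) →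
            Σ[ a ∈ Fin (suc n) ] Σ[ V ∈ (ℕ → Chain ℓ) ]
              Coherent V × (∀ j → j ℕ.< n ℕ.+ k → V j ≡ U j) × B ≃ 𝒯 (t ▷ a) k V
  realize ⟨⟩ {U} coh {B} k r t =
    Fin.zero , replace k B U , replace-coherent k coh t r ,
    (λ j → replace-miss B U) , ≡⇒≃ (sym (replace-hit k B U))
  realize {n = suc n} (t ▷ c) {U} coh {B} k r tB =
    by-shape (shape (Tails-trans y tB (Tails-sym tB)) r)
    where
    E : Chain _
    E = 𝒯 (t ▷ c) 0 U
    rE : Rank E (ω +ₒ finₒ n)
    rE = 𝒯-rank coh t c 0
    L = 𝒯-layered coh t c (fromℕ (suc n)) 0
    y = 𝒯-point coh t c (fromℕ (suc n)) 0 (point rE)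

    layering : (K : Classes B (ω +ₒ finₒ n)) → Layered B E
    layering K = transfer K L (point rE) rE y tB

    by-shape : Shape B (ω +ₒ finₒ n) → _
    by-shape (two-sided K inhabited) =
      fromℕ (suc n) , U , coh , (λ _ _ → refl) ,
      ≃-trans (two-sided-≃ (layering K) inhabited) (≡⇒≃ (sym (𝒯-top t c k U)))
    -- The fibre over 0 has the tails of E, and is realized at the left child.  The
    -- labels in E are at most n, so E is not affected by the change of family.
    by-shape (one-sided K x none)
      with realize t coh (suc k)
             (Rank-Tails x (Tails-sym (fib-tails (layering K) 0ℤ)) rE)
             (Tails-trans (point rE) (fib-tails (layering K) 0ℤ) (𝒯-tails coh t c (fromℕ n) 0 0))
    ... | a , V , coh′ , agree , e =
      inject₁ a , V , coh′ ,
      (λ j p → agree j (subst (j ℕ.<_) (sym (ℕ.+-suc n k)) p)) ,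
      ≃-trans (one-sided-≃ (layering K) x none)
        (≃-trans (⊕-cong e (⊗-cong ℕᶜ (𝒯-cong (t ▷ c) 0 U V λ j p → sym (agree j
                   (ℕ.≤-<-trans p (ℕ.+-monoʳ-< n ℕ.z<s))))))
                 (≡⇒≃ (sym (𝒯-inject₁ t c a k V))))

  realize-uniform : ∀ n (A : Chain ℓ) → Tails A A → Rank A (ω +ₒ finₒ n) →
                    Σ[ s ∈ 𝒮 (suc n) ] Σ[ U ∈ (ℕ → Chain ℓ) ] Coherent U × A ≃ 𝒯 s 0 U
  realize-uniform zero    A u r =
    ⟨⟩ ▷ Fin.zero , const A , record { common-tail = λ _ _ → u ; rank-ω = λ _ → r } , ≃-refl
  realize-uniform (suc n) A u r with shape-classes (shape u r)
    where
    shape-classes : Shape A (ω +ₒ finₒ n) → Classes A (ω +ₒ finₒ n)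
    shape-classes (two-sided K _)   = K
    shape-classes (one-sided K _ _) = K
  ... | K with realize-uniform n (class-above K x)
                 (fib-tails (self-layered K x u) _) (class-above-rank K x u r)
          where x = point r
  ...   | t ▷ b , U , coh , e
          with realize (t ▷ b) coh 0 r
                 (Layered-Tails (point (𝒯-rank coh t b 0))
                   (Layered-≃ (self-layered K (point r) u) e) (𝒯-layered coh t b (fromℕ (suc n)) 0))
  ...     | a , V , coh′ , _ , e′ = t ▷ b ▷ a , V , coh′ , e′

  -- Families on the labels of a tree

  first-leaf : ∀ {n} (s : 𝒮 (suc n)) → Fin (#leaves s)
  first-leaf {zero}  s = Fin.zero
  first-leaf {suc n} (t ▷ b ▷ a) with view a
  ... | ‵fromℕ      = first-leaf (t ▷ b)
  ... | ‵inject₁ a′ = first-leaf (t ▷ a′) ↑ˡ _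

  -- The label k if it occurs in the tree of s, and else that of the first leaf.

  label : ∀ {n} → 𝒮 (suc n) → ℕ → ℕ
  label s k with em {P = W s k}
  ... | yes _ = k
  ... | no _  = wt s (first-leaf s)

  label-∈ : ∀ {n} (s : 𝒮 (suc n)) k → W s (label s k)
  label-∈ s k with em {P = W s k}
  ... | yes p = p
  ... | no _  = first-leaf s , refl

  label-wt : ∀ {n} (s : 𝒮 (suc n)) i → label s (wt s i) ≡ wt s i
  label-wt s i with em {P = W s (wt s i)}
  ... | yes _ = refl
  ... | no ¬p = ⊥-elim (¬p (i , refl))

  𝒜-uniform-rank : ∀ {n} (s : 𝒮 (suc n)) (U : ℕ → Chain ℓ) → Admissible s U →
                   Uniform (𝒜⟨ s ⟩ U) × HasRank (𝒜⟨ s ⟩ U) (ω +ₒ finₒ n)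
  𝒜-uniform-rank s@(t ▷ a) U adm =
    Tails⇒ (Tails-≃ˡ e (Tails-≃ʳ (𝒯-tails coh t a a 0 0) e)) ,
    Rank⇒HasRank (Rank-≃ e (𝒯-rank coh t a 0))
    where
    open Admissible adm renaming (rank-ω to rank-ω′)
    V = U ∘ label s
    coh : Coherent V
    coh = record
      { common-tail = λ k l → ⇒Tails _ _ (sameTail _ _ (label-∈ s k) (label-∈ s l))
      ; rank-ω      = λ k → HasRank⇒Rank (rank-ω′ _ (label-∈ s k))
      }
    e : 𝒯 s 0 V ≃ 𝒜⟨ s ⟩ U
    e = ≃-sym (𝒜-𝒯 s 0 _ V λ i → cong U (sym (label-wt s i)))

  admissible : ∀ {n} (s : 𝒮 (suc n)) {U : ℕ → Chain ℓ} → Coherent U → Admissible s U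
  admissible s coh = record
    { uniform  = λ k _ → Tails⇒ (common-tail coh k k)
    ; rank-ω   = λ k _ → Rank⇒HasRank (rank-ω coh k)
    ; sameTail = λ k l _ _ → Tails⇒ (common-tail coh k l)
    }

  -- Ordinals between ω and ω + ω

  -- An ordinal between ω and some ω + N is some ω + n, up to presentation.

  ω+n : ∀ N → ω ≤ₒ α → α ≤ₒ ω +ₒ finₒ N →
        ∃[ n ] α ≤ₒ ω +ₒ finₒ n × ω +ₒ finₒ n ≤ₒ α
  ω+n zero    ω≤α α≤ω = 0 , α≤ω , ω≤α
  ω+n {α = α} (suc N) ω≤α α≤ω+1+N with ≤ₒ-or-> α (ω +ₒ finₒ N)
  ... | inj₁ α≤ω+N = ω+n N ω≤α α≤ω+N
  ... | inj₂ ω+N<α = suc N , α≤ω+1+N , ω+N<α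

  Rank-≈ : α ≤ₒ β → β ≤ₒ α → Rank A α → Rank A β
  Rank-≈ {A = A} α≤β β≤α r = record
    { point     = point r
    ; collapsed = collapse λ x y → ρ-mono A α≤β (related (collapsed r) x y)
    ; minimal   = λ γ γ<β → minimal r γ (≤ₒ-trans γ<β β≤α)
    }

  uniform-𝒜 : ∀ (A : Chain ℓ) α → Uniform A → HasRank A α → ω <ₒ α → α <ₒ ω +ₒ ω →
              Σ[ n ∈ ℕ ] Σ[ s ∈ 𝒮 (suc n) ] Σ[ U ∈ (ℕ → Chain ℓ) ]
                (Admissible s U × A ≅ 𝒜⟨ s ⟩ U)
  uniform-𝒜 A α u r ω<α (≤lim (lift N) α<ω+N)
    with ω+n N (≤ₒ-trans α≤1+α ω<α) (≤ₒ-trans α≤1+α α<ω+N)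
  ... | n , α≤ω+n , ω+n≤α
    with realize-uniform n A (⇒Tails A A u) (Rank-≈ α≤ω+n ω+n≤α (HasRank⇒Rank r))
  ... | s , U , coh , e =
    n , s , U , admissible s coh , ≃⇒≅ (≃-trans e (≃-sym (𝒜-𝒯 s 0 _ U λ _ → refl)))

mainTheorem1 : (∀ {ℓ′ : Level} → ExcludedMiddle ℓ′) → ∀ (ℓ : Level) →
    (∀ (n : ℕ) (s : 𝒮 (suc n)) (U : ℕ → Chain ℓ) → Admissible s U →
    Uniform (𝒜⟨ s ⟩ U) × HasRank (𝒜⟨ s ⟩ U) (ω +ₒ finₒ n))
    × (∀ (A : Chain ℓ) (α : Ord ℓ) → Uniform A → HasRank A α → ω <ₒ α → α <ₒ ω +ₒ ω →
    Σ[ n ∈ ℕ ] Σ[ s ∈ 𝒮 (suc n) ] Σ[ U ∈ (ℕ → Chain ℓ) ]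
    (Admissible s U × A ≅ 𝒜⟨ s ⟩ U))
mainTheorem1 em ℓ = (λ n s U → 𝒜-uniform-rank em s U) , uniform-𝒜 em
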